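{- Let $w_1,w_2,w_3$ be any odd positive integers, let $n\ge 0$ be an integer and let $y_1\in\mathbb{Z}_p$. Then \begin{align*} &(w_1w_2)^{n}\sum_{i=0}^{w_1-1}\sum_{j=0}^{w_2-1}(-1)^{i+j}q^{w_3(w_2i+w_1j)}E_{n,q^{w_1w_2}}\Big(w_3y_1+\frac{w_3}{w_1}i+\frac{w_3}{w_2}j\Big)\\ =&(w_2w_3)^{n}\sum_{i=0}^{w_2-1}\sum_{j=0}^{w_3-1}(-1)^{i+j}q^{w_1(w_3i+w_2j)}E_{n,q^{w_2w_3}}\Big(w_1y_1+\frac{w_1}{w_2}i+\frac{w_1}{w_3}j\Big)\\ =&(w_3w_1)^{n}\sum_{i=0}^{w_3-1}\sum_{j=0}^{w_1-1}(-1)^{i+j}q^{w_2(w_1i+w_3j)}E_{n,q^{w_1w_3}}\Big(w_2y_1+\frac{w_2}{w_3}i+\frac{w_2}{w_1}j\Big). \end{align*}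
   Context: Let $p$ be a fixed odd prime, $\mathbb{C}_p$ the completion of an algebraic closure of $\mathbb{Q}_p$ with absolute value normalized by $|p|_p=1/p$, and let $q\in\mathbb{C}_p$ be fixed with $|q-1|_p<p^{ -1/(p-1)}$. For $r\in\mathbb{C}_p$ with $|r-1|_p<p^{ -1/(p-1)}$ (in particular for $r=q^w$, $w$ a positive integer), the $r$-Euler polynomials $E_{n,r}(x)$ ($n\ge 0$) are the polynomials in $x$ defined by the generating function $$\frac{2}{re^{t}+1}e^{xt}=\sum_{n=0}^{\infty}E_{n,r}(x)\frac{t^n}{n!}.$$ -}

module Defs where

import Algebra.Apartness.Properties.HeytingCommutativeRing as HeytingProperties
import Algebra.Definitions.RawMonoid as RawSum
open import Algebra using (CommutativeRing; RawSemiring; Semiring)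
open import Algebra.Apartness using (HeytingField; HeytingCommutativeRing)
open import Algebra.Morphism.Construct.Composition using () renaming (isRingHomomorphism to ∘-isRingHomomorphism)
open import Algebra.Morphism.Structures using (module RingMorphisms)
import Algebra.Properties.AbelianGroup as AbelianGroupProperties
import Algebra.Properties.Monoid.Sum as Sum
import Algebra.Properties.Ring as RingProperties
import Algebra.Properties.Semiring.Exp as Exp
open import Data.Empty using (⊥-elim)
open import Data.Fin as Fin using (Fin; toℕ)
open import Data.Integer as ℤ using (ℤ; +_)
import Data.Integer.Properties as ℤ
import Data.Integer.Tactic.RingSolver as ℤR
open import Data.List using (List; []; _∷_; map; replicate; _++_)
open import Data.Nat as ℕ using (ℕ; zero; suc; NonZero; NonTrivial)
open import Data.Nat.Divisibility using (_∣_; _∣?_; divides; *-cancelˡ-∣; ∣-refl; ∣-trans; m∣m*n; n∣m*n; ∣⇒≤)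
import Data.Nat.Properties as ℕ
import Data.Nat.Tactic.RingSolver as ℕR
open import Data.Nat.Primality using (Prime; euclidsLemma; prime⇒nonTrivial; prime⇒nonZero)
open import Data.Product using (∃-syntax; Σ-syntax; _×_; _,_; proj₁; proj₂)
open import Data.Rational as ℚ using (ℚ; 0ℚ; ↥_; ↧_; ↧ₙ_; toℚᵘ)
import Data.Rational.Properties as ℚ
import Data.Rational.Unnormalised as ℚᵘ
import Data.Rational.Unnormalised.Properties as ℚᵘ
open import Data.Sum using (_⊎_; inj₁; inj₂; [_,_]′)
open import Data.Vec.Functional as Vector using (Vector)
open import Level using (Level; _⊔_; 0ℓ) renaming (suc to lsuc)
import Relation.Binary.Reasoning.Setoid as ≈-Reasoning
open import Relation.Binary.PropositionalEquality using (_≡_; _≢_; refl; sym; trans; cong; cong₂; subst; subst₂; module ≡-Reasoning)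
open import Relation.Nullary using (¬_; yes; no)
open import Relation.Nullary.Decidable using (decidable-stable)

private variable
  c ℓ₁ ℓ₂ c′ ℓ₁′ ℓ₂′ c″ ℓ₁″ ℓ₂″ : Level

-- A field with a non-archimedean absolute value, written additively:
-- |x| = p^(- v x) for x ≠ 0, and v 0 = ∞.  Rational values suffice because the
-- value groups of ℚₚ, its algebraic closure and ℂₚ are p^ℤ, p^ℚ and p^ℚ.
record ValuedField c ℓ₁ ℓ₂ : Set (lsuc (c ⊔ ℓ₁ ⊔ ℓ₂)) where
  field
    heytingField : HeytingField c ℓ₁ ℓ₂

  open HeytingField heytingField public

  commutativeRing : CommutativeRing c ℓ₁
  commutativeRing = HeytingCommutativeRing.commutativeRing heytingCommutativeRing

  open CommutativeRing commutativeRing public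
    using (rawRing; ring; semiring; +-monoid)
  open Exp semiring public using (_^_)
  open Sum +-monoid public using (sum; sum-syntax)

  rawSemiring : RawSemiring c ℓ₁
  rawSemiring = Semiring.rawSemiring semiring

  field
    v      : ∀ x → x # 0# → ℚ
    v-cong : ∀ {x y} → x ≈ y → ∀ x#0 y#0 → v x x#0 ≡ v y y#0
    v-*    : ∀ {x y} x#0 y#0 xy#0 → v (x * y) xy#0 ≡ v x x#0 ℚ.+ v y y#0
    v-+    : ∀ {x y} x#0 y#0 x+y#0 → v x x#0 ℚ.⊓ v y y#0 ℚ.≤ v (x + y) x+y#0

    -- |x| can be compared with p^(-s); classically this is automatic.
    v-located : ∀ x s → (∃[ x#0 ] v x x#0 ℚ.≤ s) ⊎ (∀ x#0 → s ℚ.< v x x#0)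

  infix 4 _≤v_ _<v_

  -- s ≤ v x and s < v x, with v 0 = ∞; that is, |x| ≤ p^(-s) and |x| < p^(-s).
  _≤v_ _<v_ : ℚ → Carrier → Set ℓ₂
  s ≤v x = ∀ x#0 → s ℚ.≤ v x x#0
  s <v x = ∀ x#0 → s ℚ.< v x x#0

  Cauchy : (ℕ → Carrier) → Set ℓ₂
  Cauchy x = ∀ s → ∃[ N ] (∀ m n → N ℕ.≤ m → N ℕ.≤ n → s ≤v (x m - x n))

  _⟶_ : (ℕ → Carrier) → Carrier → Set ℓ₂
  x ⟶ l = ∀ s → ∃[ N ] (∀ n → N ℕ.≤ n → s ≤v (x n - l))

  -- x^n + a_{n-1} x^{n-1} + ... + a_0
  monicEval : ∀ {n} → Vector Carrier n → Carrier → Carrier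
  monicEval {n} a x = x ^ n + ∑[ i < n ] (a i * x ^ toℕ i)

module ValuedFieldProperties (K : ValuedField c ℓ₁ ℓ₂) where
  open ValuedField K renaming (sym to ≈-sym; trans to ≈-trans; refl to ≈-refl)
  open HeytingProperties heytingCommutativeRing public using (1#0; #-congʳ; invertibleˡ⇒#; x-0≈x)
  open AbelianGroupProperties (CommutativeRing.+-abelianGroup commutativeRing) using (⁻¹-anti-homo-//)
  open RingProperties ring using (-‿distribˡ-*; -‿distribʳ-*; -‿involutive)

  private
    x-y+y≈x : ∀ x y → x - y + y ≈ x
    x-y+y≈x x y = ≈-trans (+-assoc x (- y) y) (≈-trans (+-congˡ (-‿inverseˡ y)) (+-identityʳ x))

  <v-cong : ∀ {s x y} → x ≈ y → s <v x → s <v y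
  <v-cong {s} x≈y s<x y#0 =
    subst (s ℚ.<_) (v-cong x≈y (#-congʳ (≈-sym x≈y) y#0) y#0) (s<x _)

  <v-0 : ∀ {s x} → x ≈ 0# → s <v x
  <v-0 x≈0 x#0 = ⊥-elim (#-irrefl x≈0 x#0)

  <v-+ : ∀ {s x y} → s <v x → s <v y → s <v (x + y)
  <v-+ {s} {x} {y} s<x s<y x+y#0 = decidable-stable (s ℚ.<? v (x + y) x+y#0) λ s≮ →
    let x≈0 : x ≈ 0#
        x≈0 = proj₁ (tight x 0#) λ x#0 →
          let y≈0 : y ≈ 0#
              y≈0 = proj₁ (tight y 0#) λ y#0 → s≮ (ℚ.<-≤-trans
                      (s<⊓ (v x x#0) (v y y#0) (s<x x#0) (s<y y#0)) (v-+ x#0 y#0 x+y#0))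
          in s≮ (<v-cong (≈-trans (≈-sym (+-identityʳ x)) (+-congˡ (≈-sym y≈0))) s<x x+y#0)
    in s≮ (<v-cong (≈-trans (≈-sym (+-identityˡ y)) (+-congʳ (≈-sym x≈0))) s<y x+y#0)
    where
    s<⊓ : ∀ a b → s ℚ.< a → s ℚ.< b → s ℚ.< a ℚ.⊓ b
    s<⊓ a b s<a s<b with ℚ.⊓-sel a b
    ... | inj₁ eq = subst (s ℚ.<_) (sym eq) s<a
    ... | inj₂ eq = subst (s ℚ.<_) (sym eq) s<b

  *#0⇒#0 : ∀ {x y} → x * y # 0# → x # 0# × y # 0#
  *#0⇒#0 {x} {y} xy#0 with #⇒invertible xy#0
  ... | z , z*xy≈1 , _ =
      invertibleˡ⇒# (z * y , ≈-trans (*-congˡ (x-0≈x x)) (≈-trans (assoc₁ z x y) z*xy))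
    , invertibleˡ⇒# (z * x , ≈-trans (*-congˡ (x-0≈x y)) (≈-trans (*-assoc z x y) z*xy))
    where
    z*xy : z * (x * y) ≈ 1#
    z*xy = ≈-trans (*-congˡ (≈-sym (x-0≈x (x * y)))) z*xy≈1
    assoc₁ : ∀ z x y → z * y * x ≈ z * (x * y)
    assoc₁ z x y = ≈-trans (*-assoc z y x) (*-congˡ (*-comm y x))

  <v-* : ∀ {s x y} → 0ℚ ℚ.< s → s <v x → s <v y → s <v (x * y)
  <v-* {s} {x} {y} 0<s s<x s<y xy#0 = subst₂ ℚ._<_ (ℚ.+-identityʳ s) (sym (v-* x#0 y#0 xy#0))
    (ℚ.+-mono-< (s<x x#0) (ℚ.<-trans 0<s (s<y y#0)))
    where
    x#0 = proj₁ (*#0⇒#0 xy#0)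
    y#0 = proj₂ (*#0⇒#0 xy#0)

  0<v-neg : ∀ {x} → 0ℚ <v x → 0ℚ <v - x
  0<v-neg {x} 0<x -x#0 with 0ℚ ℚ.<? v (- x) -x#0
  ... | yes 0<-x = 0<-x
  ... | no  0≮-x = ⊥-elim (ℚ.<-irrefl refl (ℚ.<-≤-trans 0<xx xx≤0))
    where
    xx≈ : - x * - x ≈ x * x
    xx≈ = ≈-trans (≈-sym (-‿distribˡ-* x (- x)))
            (≈-trans (-‿cong (≈-sym (-‿distribʳ-* x x))) (-‿involutive (x * x)))
    open HeytingProperties heytingCommutativeRing using (x#0y#0→xy#0)
    -xx#0 : - x * - x # 0#
    -xx#0 = x#0y#0→xy#0 -x#0 -x#0
    xx#0 : x * x # 0#
    xx#0 = #-congʳ xx≈ -xx#0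
    x#0 = proj₁ (*#0⇒#0 xx#0)
    0<xx : 0ℚ ℚ.< v (x * x) xx#0
    0<xx = subst (0ℚ ℚ.<_) (sym (v-* x#0 x#0 xx#0)) (ℚ.+-mono-< (0<x x#0) (0<x x#0))
    xx≤0 : v (x * x) xx#0 ℚ.≤ 0ℚ
    xx≤0 = subst (ℚ._≤ 0ℚ) (trans (sym (v-* -x#0 -x#0 -xx#0)) (v-cong xx≈ -xx#0 xx#0))
             (ℚ.+-mono-≤ (ℚ.≮⇒≥ 0≮-x) (ℚ.≮⇒≥ 0≮-x))

  <v-pow : ∀ {s} x n → 0ℚ ℚ.< s → s <v (x - 1#) → s <v (x ^ n - 1#)
  <v-pow x zero    0<s s<x-1 = <v-0 (-‿inverseʳ 1#)
  <v-pow x (suc n) 0<s s<x-1 = <v-cong (identity x (x ^ n))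
    (<v-+ (<v-+ (<v-* 0<s s<x-1 ih) ih) s<x-1)
    where
    ih = <v-pow x n 0<s s<x-1
    open ≈-Reasoning setoid
    identity : ∀ x y → (x - 1#) * (y - 1#) + (y - 1#) + (x - 1#) ≈ x * y - 1#
    identity x y = begin
      (x - 1#) * (y - 1#) + (y - 1#) + (x - 1#)       ≈⟨ +-congʳ (+-congˡ (*-identityˡ _)) ⟨
      (x - 1#) * (y - 1#) + 1# * (y - 1#) + (x - 1#)  ≈⟨ +-congʳ (distribʳ _ _ _) ⟨
      (x - 1# + 1#) * (y - 1#) + (x - 1#)             ≈⟨ +-congʳ (*-congʳ (x-y+y≈x x 1#)) ⟩
      x * (y - 1#) + (x - 1#)                         ≈⟨ +-congʳ (distribˡ x y (- 1#)) ⟩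
      x * y + x * - 1# + (x - 1#)                     ≈⟨ +-congʳ (+-congˡ (-‿distribʳ-* x 1#)) ⟨
      x * y - x * 1# + (x - 1#)                       ≈⟨ +-congʳ (+-congˡ (-‿cong (*-identityʳ x))) ⟩
      x * y - x + (x - 1#)                            ≈⟨ +-assoc _ x (- 1#) ⟨
      x * y - x + x - 1#                              ≈⟨ +-congʳ (x-y+y≈x (x * y) x) ⟩
      x * y - 1#                                      ∎

  1+1-unit⇒1+x#0 : (2#0 : 1# + 1# # 0#) → v (1# + 1#) 2#0 ≡ 0ℚ →
                   ∀ {x} → 0ℚ <v (x - 1#) → x + 1# # 0#
  1+1-unit⇒1+x#0 2#0 v2≡0 {x} 0<x-1 with v-located (x + 1#) 0ℚ
  ... | inj₁ (x+1#0 , _) = x+1#0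
  ... | inj₂ 0<x+1 = ⊥-elim (ℚ.<-irrefl (sym v2≡0)
          (<v-cong (identity x) (<v-+ 0<x+1 (0<v-neg 0<x-1)) 2#0))
    where
    open ≈-Reasoning setoid
    identity : ∀ x → x + 1# + - (x - 1#) ≈ 1# + 1#
    identity x = begin
      x + 1# + - (x - 1#)   ≈⟨ +-congˡ (⁻¹-anti-homo-// x 1#) ⟩
      x + 1# + (1# - x)     ≈⟨ +-comm _ _ ⟩
      1# - x + (x + 1#)     ≈⟨ +-assoc _ x 1# ⟨
      1# - x + x + 1#       ≈⟨ +-congʳ (x-y+y≈x 1# x) ⟩
      1# + 1#               ∎

-- An embedding of fields preserving the absolute value.
record Embedding (F : ValuedField c ℓ₁ ℓ₂) (K : ValuedField c′ ℓ₁′ ℓ₂′)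
                 : Set (c ⊔ ℓ₁ ⊔ ℓ₂ ⊔ c′ ⊔ ℓ₁′ ⊔ ℓ₂′) where
  private
    module F = ValuedField F
    module K = ValuedField K
  open RingMorphisms F.rawRing K.rawRing using (IsRingHomomorphism)
  field
    ⟦_⟧                : F.Carrier → K.Carrier
    isRingHomomorphism : IsRingHomomorphism ⟦_⟧
    v-preserving       : ∀ x x#0 ⟦x⟧#0 → K.v ⟦ x ⟧ ⟦x⟧#0 ≡ F.v x x#0

  open IsRingHomomorphism isRingHomomorphism public

  #0-preserving : ∀ {x} → x F.# F.0# → ⟦ x ⟧ K.# K.0#
  #0-preserving {x} x#0 with F.#⇒invertible x#0
  ... | y , yx≈1 , _ = KP.invertibleˡ⇒# (⟦ y ⟧ ,
      K.trans (K.*-congˡ (KP.x-0≈x ⟦ x ⟧))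
        (K.trans (K.sym (*-homo y x))
          (K.trans (⟦⟧-cong (F.trans (F.*-congˡ (F.sym (FP.x-0≈x x))) yx≈1)) 1#-homo)))
    where
    module FP = ValuedFieldProperties F
    module KP = ValuedFieldProperties K

_∘ᵉ_ : {F : ValuedField c ℓ₁ ℓ₂} {G : ValuedField c′ ℓ₁′ ℓ₂′} {K : ValuedField c″ ℓ₁″ ℓ₂″} →
       Embedding G K → Embedding F G → Embedding F K
_∘ᵉ_ {K = K} g f = record
  { ⟦_⟧                = λ x → g.⟦ f.⟦ x ⟧ ⟧
  ; isRingHomomorphism = ∘-isRingHomomorphism (ValuedField.trans K) f.isRingHomomorphism g.isRingHomomorphism
  ; v-preserving       = λ x x#0 gfx#0 →
      trans (g.v-preserving f.⟦ x ⟧ (f.#0-preserving x#0) gfx#0)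
            (f.v-preserving x x#0 (f.#0-preserving x#0))
  }
  where
  module g = Embedding g
  module f = Embedding f

record Completion (F : ValuedField c ℓ₁ ℓ₂) c′ ℓ₁′ ℓ₂′
                  : Set (c ⊔ ℓ₁ ⊔ ℓ₂ ⊔ lsuc (c′ ⊔ ℓ₁′ ⊔ ℓ₂′)) where
  field
    valuedField : ValuedField c′ ℓ₁′ ℓ₂′
    embedding   : Embedding F valuedField
  open ValuedField valuedField
  open Embedding embedding using (⟦_⟧)
  field
    dense    : ∀ x s → ∃[ a ] s ≤v (x - ⟦ a ⟧)
    complete : ∀ x → Cauchy x → ∃[ l ] x ⟶ l

-- An algebraic closure together with an extension of the absolute value
-- (over a complete field there is exactly one).
record AlgebraicClosure (F : ValuedField c ℓ₁ ℓ₂) c′ ℓ₁′ ℓ₂′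
                        : Set (c ⊔ ℓ₁ ⊔ ℓ₂ ⊔ lsuc (c′ ⊔ ℓ₁′ ⊔ ℓ₂′)) where
  field
    valuedField : ValuedField c′ ℓ₁′ ℓ₂′
    embedding   : Embedding F valuedField
  open ValuedField valuedField
  open Embedding embedding using (⟦_⟧)
  field
    algebraic : ∀ x → ∃[ n ] (Σ[ a ∈ Vector (ValuedField.Carrier F) n ] monicEval (λ i → ⟦ a i ⟧) x ≈ 0#)
    closed    : ∀ n (a : Vector Carrier (suc n)) → ∃[ x ] monicEval a x ≈ 0#

ord′ : ℕ → ℕ → ℕ → ℕ
ord′ zero       p n = 0
ord′ (suc fuel) p n with p ∣? n
... | yes (divides m _) = suc (ord′ fuel p m)
... | no  _             = 0

-- The exponent of p in n, for p ≥ 2 and n ≥ 1; n itself is enough fuel.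
ord : ℕ → ℕ → ℕ
ord p n = ord′ n p n

ℤ⇒ℚ : ℤ → ℚ
ℤ⇒ℚ i = i ℚ./ 1

ordℚ : ℕ → ℚ → ℤ
ordℚ p x = + ord p ℤ.∣ ↥ x ∣ ℤ.- + ord p (↧ₙ x)

ℤ⇒ℚᵘ : ∀ i → toℚᵘ (ℤ⇒ℚ i) ℚᵘ.≃ (i ℚᵘ./ 1)
ℤ⇒ℚᵘ i = ℚ.toℚᵘ-fromℚᵘ (i ℚᵘ./ 1)

ℤ⇒ℚ-+ : ∀ i j → ℤ⇒ℚ (i ℤ.+ j) ≡ ℤ⇒ℚ i ℚ.+ ℤ⇒ℚ j
ℤ⇒ℚ-+ i j = ℚ.toℚᵘ-injective (begin
  toℚᵘ (ℤ⇒ℚ (i ℤ.+ j))                ≈⟨ ℤ⇒ℚᵘ (i ℤ.+ j) ⟩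
  (i ℤ.+ j) ℚᵘ./ 1                    ≈⟨ ℚᵘ.*≡* (solve i j) ⟩
  (i ℚᵘ./ 1) ℚᵘ.+ (j ℚᵘ./ 1)          ≈⟨ ℚᵘ.+-cong (ℤ⇒ℚᵘ i) (ℤ⇒ℚᵘ j) ⟨
  toℚᵘ (ℤ⇒ℚ i) ℚᵘ.+ toℚᵘ (ℤ⇒ℚ j)      ≈⟨ ℚ.toℚᵘ-homo-+ (ℤ⇒ℚ i) (ℤ⇒ℚ j) ⟨
  toℚᵘ (ℤ⇒ℚ i ℚ.+ ℤ⇒ℚ j)              ∎)
  where
  open import Relation.Binary.Reasoning.Setoid ℚᵘ.≃-setoid
  solve : ∀ i j → (i ℤ.+ j) ℤ.* (+ 1 ℤ.* + 1) ≡ (i ℤ.* + 1 ℤ.+ j ℤ.* + 1) ℤ.* + 1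
  solve = ℤR.solve-∀

ℤ⇒ℚ-mono : ∀ {i j} → i ℤ.≤ j → ℤ⇒ℚ i ℚ.≤ ℤ⇒ℚ j
ℤ⇒ℚ-mono {i} {j} i≤j = ℚ.toℚᵘ-cancel-≤
  (ℚᵘ.≤-respˡ-≃ (ℚᵘ.≃-sym (ℤ⇒ℚᵘ i)) (ℚᵘ.≤-respʳ-≃ (ℚᵘ.≃-sym (ℤ⇒ℚᵘ j))
    (ℚᵘ.*≤* (ℤ.*-monoʳ-≤-nonNeg (+ 1) i≤j))))

module _ {p : ℕ} (p-prime : Prime p) where

  private instance
    _ : NonTrivial p
    _ = prime⇒nonTrivial p-prime
    _ : NonZero p
    _ = prime⇒nonZero p-prime

  Exact : ℕ → ℕ → Set
  Exact k n = ∃[ m ] n ≡ m ℕ.* p ℕ.^ k × ¬ p ∣ m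

  ord′-exact : ∀ f n .{{_ : NonZero n}} → n ℕ.≤ f → Exact (ord′ f p n) n
  ord′-exact zero    (suc n) ()
  ord′-exact (suc f) n n≤f with p ∣? n
  ... | no p∤n = n , sym (ℕ.*-identityʳ n) , p∤n
  ... | yes (divides m eq) = step (ord′-exact f m m≤f)
    where
    instance
      m≢0 : NonZero m
      m≢0 = ℕ.≢-nonZero λ { refl → ℕ.≢-nonZero⁻¹ n eq }
    m<n : m ℕ.< n
    m<n = subst (m ℕ.<_) (sym eq) (ℕ.m<m*n m p (ℕ.nonTrivial⇒n>1 p))
    m≤f : m ℕ.≤ f
    m≤f = ℕ.s≤s⁻¹ (ℕ.≤-trans m<n n≤f)
    step : Exact (ord′ f p m) m → Exact (suc (ord′ f p m)) n
    step (l , eq′ , p∤l) = l , trans eq (trans (cong (ℕ._* p) eq′) (lem l (p ℕ.^ ord′ f p m) p)) , p∤l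
      where
      lem : ∀ a b c → a ℕ.* b ℕ.* c ≡ a ℕ.* (c ℕ.* b)
      lem = ℕR.solve-∀

  ord-exact : ∀ n .{{_ : NonZero n}} → Exact (ord p n) n
  ord-exact n = ord′-exact n n ℕ.≤-refl

  exact-max : ∀ j k {n} → p ℕ.^ j ∣ n → Exact k n → j ℕ.≤ k
  exact-max zero    k       _ _ = ℕ.z≤n
  exact-max (suc j) zero    pʲ∣n (m , refl , p∤m) =
    ⊥-elim (p∤m (subst (p ∣_) (ℕ.*-identityʳ m) (∣-trans (m∣m*n (p ℕ.^ j)) pʲ∣n)))
  exact-max (suc j) (suc k) pʲ∣n (m , refl , p∤m) =
    ℕ.s≤s (exact-max j k (*-cancelˡ-∣ p (subst (p ℕ.^ suc j ∣_) (lem m p (p ℕ.^ k)) pʲ∣n)) (m , refl , p∤m))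
    where
    lem : ∀ a b c → a ℕ.* (b ℕ.* c) ≡ b ℕ.* (a ℕ.* c)
    lem = ℕR.solve-∀

  exact-∣ : ∀ {k n} → Exact k n → p ℕ.^ k ∣ n
  exact-∣ {k} (m , refl , _) = n∣m*n m

  ord-∣ : ∀ n .{{_ : NonZero n}} → p ℕ.^ ord p n ∣ n
  ord-∣ n = exact-∣ {ord p n} (ord-exact n)

  ord-unique : ∀ {k n} .{{_ : NonZero n}} → Exact k n → ord p n ≡ k
  ord-unique {k} {n} e = ℕ.≤-antisym
    (exact-max _ k (ord-∣ n) e) (exact-max k _ (exact-∣ {k} e) (ord-exact n))

  ord-* : ∀ m n .{{_ : NonZero m}} .{{_ : NonZero n}} → ord p (m ℕ.* n) ≡ ord p m ℕ.+ ord p n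
  ord-* m n with ord-exact m | ord-exact n
  ... | a , eqa , p∤a | b , eqb , p∤b = ord-unique {{ℕ.m*n≢0 m n}}
    ( a ℕ.* b
    , trans (cong₂ ℕ._*_ eqa eqb)
        (trans (lem a _ b _) (cong (a ℕ.* b ℕ.*_) (sym (ℕ.^-distribˡ-+-* p (ord p m) (ord p n)))))
    , λ p∣ab → [ p∤a , p∤b ]′ (euclidsLemma a b p-prime p∣ab))
    where
    lem : ∀ a b c d → a ℕ.* b ℕ.* (c ℕ.* d) ≡ a ℕ.* c ℕ.* (b ℕ.* d)
    lem = ℕR.solve-∀

  ↥-nonZero : ∀ {x} → x ≢ 0ℚ → NonZero ℤ.∣ ↥ x ∣
  ↥-nonZero {x} x≢0 = ℕ.≢-nonZero λ eq → x≢0 (ℚ.↥p≡0⇒p≡0 x (ℤ.∣i∣≡0⇒i≡0 eq))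

  -- ordℚ can be computed from any representation x = a / b.
  ordℚ-rep : ∀ x a b .{{_ : NonZero b}} → x ≢ 0ℚ →
             ↥ x ℤ.* + b ≡ a ℤ.* ↧ x →
             NonZero ℤ.∣ a ∣ × ordℚ p x ≡ + ord p ℤ.∣ a ∣ ℤ.- + ord p b
  ordℚ-rep x a b x≢0 eq = a≢0 , (begin
    + n ℤ.- + d                               ≡⟨ lem (+ n) (+ d) (+ b′) ⟩
    (+ n ℤ.+ + b′) ℤ.- + d ℤ.- + b′           ≡⟨ cong (λ t → + t ℤ.- + d ℤ.- + b′) ords ⟩
    (+ a′ ℤ.+ + d) ℤ.- + d ℤ.- + b′           ≡⟨ lem′ (+ a′) (+ d) (+ b′) ⟩
    + a′ ℤ.- + b′                             ∎)
    where
    open ≡-Reasoning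
    instance
      x′ : NonZero ℤ.∣ ↥ x ∣
      x′ = ↥-nonZero x≢0
    eqℕ : ℤ.∣ ↥ x ∣ ℕ.* b ≡ ℤ.∣ a ∣ ℕ.* ↧ₙ x
    eqℕ = trans (sym (ℤ.abs-* (↥ x) (+ b))) (trans (cong ℤ.∣_∣ eq) (ℤ.abs-* a (↧ x)))
    instance
      a≢0 : NonZero ℤ.∣ a ∣
      a≢0 = ℕ.≢-nonZero λ a≡0 → ℕ.≢-nonZero⁻¹ (ℤ.∣ ↥ x ∣ ℕ.* b) {{ℕ.m*n≢0 ℤ.∣ ↥ x ∣ b}}
              (trans eqℕ (cong (ℕ._* ↧ₙ x) a≡0))
    n  = ord p ℤ.∣ ↥ x ∣
    d  = ord p (↧ₙ x)
    a′ = ord p ℤ.∣ a ∣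
    b′ = ord p b
    ords : n ℕ.+ b′ ≡ a′ ℕ.+ d
    ords = trans (sym (ord-* ℤ.∣ ↥ x ∣ b)) (trans (cong (ord p) eqℕ) (ord-* ℤ.∣ a ∣ (↧ₙ x)))
    lem : ∀ n d b → n ℤ.- d ≡ (n ℤ.+ b) ℤ.- d ℤ.- b
    lem = ℤR.solve-∀
    lem′ : ∀ a d b → (a ℤ.+ d) ℤ.- d ℤ.- b ≡ a ℤ.- b
    lem′ = ℤR.solve-∀

  ordℚ-* : ∀ {x y} → x ≢ 0ℚ → y ≢ 0ℚ → x ℚ.* y ≢ 0ℚ → ordℚ p (x ℚ.* y) ≡ ordℚ p x ℤ.+ ordℚ p y
  ordℚ-* {x@record{}} {y@record{}} x≢0 y≢0 xy≢0 with ℚ.toℚᵘ-homo-* x y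
  ... | ℚᵘ.*≡* eq = begin
    ordℚ p (x ℚ.* y)
      ≡⟨ proj₂ (ordℚ-rep (x ℚ.* y) (↥ x ℤ.* ↥ y) (↧ₙ x ℕ.* ↧ₙ y) xy≢0 eq′) ⟩
    + ord p ℤ.∣ ↥ x ℤ.* ↥ y ∣ ℤ.- + ord p (↧ₙ x ℕ.* ↧ₙ y)
      ≡⟨ cong₂ (λ s t → + s ℤ.- + t)
           (trans (cong (ord p) (ℤ.abs-* (↥ x) (↥ y))) (ord-* ℤ.∣ ↥ x ∣ ℤ.∣ ↥ y ∣))
           (ord-* (↧ₙ x) (↧ₙ y)) ⟩
    (+ a ℤ.+ + b) ℤ.- (+ e ℤ.+ + d)
      ≡⟨ lem (+ a) (+ b) (+ e) (+ d) ⟩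
    ordℚ p x ℤ.+ ordℚ p y ∎
    where
    open ≡-Reasoning
    instance
      _ : NonZero ℤ.∣ ↥ x ∣
      _ = ↥-nonZero x≢0
      _ : NonZero ℤ.∣ ↥ y ∣
      _ = ↥-nonZero y≢0
    a = ord p ℤ.∣ ↥ x ∣
    b = ord p ℤ.∣ ↥ y ∣
    e = ord p (↧ₙ x)
    d = ord p (↧ₙ y)
    lem : ∀ a b e d → (a ℤ.+ b) ℤ.- (e ℤ.+ d) ≡ (a ℤ.- e) ℤ.+ (b ℤ.- d)
    lem = ℤR.solve-∀
    eq′ : ↥ (x ℚ.* y) ℤ.* + (↧ₙ x ℕ.* ↧ₙ y) ≡ ↥ x ℤ.* ↥ y ℤ.* ↧ (x ℚ.* y)
    eq′ = subst₂ (λ s t → s ℤ.* + (↧ₙ x ℕ.* ↧ₙ y) ≡ ↥ x ℤ.* ↥ y ℤ.* t)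
            (ℚ.↥ᵘ-toℚᵘ (x ℚ.* y)) (ℚ.↧ᵘ-toℚᵘ (x ℚ.* y)) eq

  ∣ℤ⇒∣+ : ∀ {m} i j → m ∣ ℤ.∣ i ∣ → m ∣ ℤ.∣ j ∣ → m ∣ ℤ.∣ i ℤ.+ j ∣
  ∣ℤ⇒∣+ {m} i j m∣i m∣j =
    S.∣⇒∣ᵤ (S.∣m∣n⇒∣m+n (S.∣ᵤ⇒∣ {+ m} {i} m∣i) (S.∣ᵤ⇒∣ {+ m} {j} m∣j))
    where import Data.Integer.Divisibility.Signed as S

  ordℚ-+ : ∀ {x y} → x ≢ 0ℚ → y ≢ 0ℚ → x ℚ.+ y ≢ 0ℚ →
           ordℚ p x ℤ.≤ ordℚ p y → ordℚ p x ℤ.≤ ordℚ p (x ℚ.+ y)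
  ordℚ-+ {x@record{}} {y@record{}} x≢0 y≢0 x+y≢0 x≤y with ℚ.toℚᵘ-homo-+ x y
  ... | ℚᵘ.*≡* eq = ≤-begin
    where
    num = ↥ x ℤ.* ↧ y ℤ.+ ↥ y ℤ.* ↧ x
    instance
      _ : NonZero ℤ.∣ ↥ x ∣
      _ = ↥-nonZero x≢0
      _ : NonZero ℤ.∣ ↥ y ∣
      _ = ↥-nonZero y≢0
    eq′ : ↥ (x ℚ.+ y) ℤ.* + (↧ₙ x ℕ.* ↧ₙ y) ≡ num ℤ.* ↧ (x ℚ.+ y)
    eq′ = subst₂ (λ s t → s ℤ.* + (↧ₙ x ℕ.* ↧ₙ y) ≡ num ℤ.* t)
            (ℚ.↥ᵘ-toℚᵘ (x ℚ.+ y)) (ℚ.↧ᵘ-toℚᵘ (x ℚ.+ y)) eq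
    rep = ordℚ-rep (x ℚ.+ y) num (↧ₙ x ℕ.* ↧ₙ y) x+y≢0 eq′
    instance
      num≢0 : NonZero ℤ.∣ num ∣
      num≢0 = proj₁ rep
    a = ord p ℤ.∣ ↥ x ∣
    b = ord p ℤ.∣ ↥ y ∣
    e = ord p (↧ₙ x)
    d = ord p (↧ₙ y)
    ad≤bc : a ℕ.+ d ℕ.≤ b ℕ.+ e
    ad≤bc = ℤ.drop‿+≤+ (subst₂ ℤ._≤_ (lem (+ a) (+ e) (+ d)) (lem′ (+ b) (+ e) (+ d))
              (ℤ.+-monoʳ-≤ (+ e ℤ.+ + d) x≤y))
      where
      lem : ∀ a e d → e ℤ.+ d ℤ.+ (a ℤ.- e) ≡ a ℤ.+ d
      lem = ℤR.solve-∀
      lem′ : ∀ b e d → e ℤ.+ d ℤ.+ (b ℤ.- d) ≡ b ℤ.+ e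
      lem′ = ℤR.solve-∀
    ∣₁ : p ℕ.^ (a ℕ.+ d) ∣ ℤ.∣ ↥ x ℤ.* ↧ y ∣
    ∣₁ = subst (p ℕ.^ (a ℕ.+ d) ∣_) (sym (ℤ.abs-* (↥ x) (↧ y)))
           (subst (λ k → p ℕ.^ k ∣ ℤ.∣ ↥ x ∣ ℕ.* ↧ₙ y) (ord-* ℤ.∣ ↥ x ∣ (↧ₙ y))
             (ord-∣ (ℤ.∣ ↥ x ∣ ℕ.* ↧ₙ y) {{ℕ.m*n≢0 ℤ.∣ ↥ x ∣ (↧ₙ y)}}))
    ∣₂ : p ℕ.^ (a ℕ.+ d) ∣ ℤ.∣ ↥ y ℤ.* ↧ x ∣
    ∣₂ = ∣-trans (subst (p ℕ.^ (a ℕ.+ d) ∣_)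
             (trans (sym (ℕ.^-distribˡ-+-* p (a ℕ.+ d) (b ℕ.+ e ℕ.∸ (a ℕ.+ d)))) (cong (p ℕ.^_) (ℕ.m+[n∸m]≡n ad≤bc)))
             (m∣m*n (p ℕ.^ (b ℕ.+ e ℕ.∸ (a ℕ.+ d)))))
           (subst (p ℕ.^ (b ℕ.+ e) ∣_) (sym (ℤ.abs-* (↥ y) (↧ x)))
           (subst (λ k → p ℕ.^ k ∣ ℤ.∣ ↥ y ∣ ℕ.* ↧ₙ x) (ord-* ℤ.∣ ↥ y ∣ (↧ₙ x))
             (ord-∣ (ℤ.∣ ↥ y ∣ ℕ.* ↧ₙ x) {{ℕ.m*n≢0 ℤ.∣ ↥ y ∣ (↧ₙ x)}})))
    key : a ℕ.+ d ℕ.≤ ord p ℤ.∣ num ∣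
    key = exact-max _ _ (∣ℤ⇒∣+ (↥ x ℤ.* ↧ y) (↥ y ℤ.* ↧ x) ∣₁ ∣₂) (ord-exact ℤ.∣ num ∣)
    ≤-begin : ordℚ p x ℤ.≤ ordℚ p (x ℚ.+ y)
    ≤-begin = subst₂ ℤ._≤_ (lem (+ a) (+ e) (+ d))
                (sym (trans (proj₂ rep) (cong (λ t → + ord p ℤ.∣ num ∣ ℤ.- + t) (ord-* (↧ₙ x) (↧ₙ y)))))
                (ℤ.+-monoˡ-≤ (ℤ.- (+ e ℤ.+ + d)) (ℤ.+≤+ key))
      where
      lem : ∀ a e d → a ℤ.+ d ℤ.+ ℤ.- (e ℤ.+ d) ≡ a ℤ.- e
      lem = ℤR.solve-∀

ℚ-valued : ∀ {p} → Prime p → ValuedField 0ℓ 0ℓ 0ℓ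
ℚ-valued {p} p-prime = record
  { heytingField = ℚ.heytingField
  ; v            = λ x _ → ℤ⇒ℚ (ordℚ p x)
  ; v-cong       = λ { refl _ _ → refl }
  ; v-*          = λ {x} {y} x≢0 y≢0 xy≢0 →
      trans (cong ℤ⇒ℚ (ordℚ-* p-prime x≢0 y≢0 xy≢0)) (ℤ⇒ℚ-+ (ordℚ p x) (ordℚ p y))
  ; v-+          = ultrametric
  ; v-located    = located
  }
  where
  ν : ℚ → ℚ
  ν x = ℤ⇒ℚ (ordℚ p x)

  ultrametric : ∀ {x y} → x ≢ 0ℚ → y ≢ 0ℚ → x ℚ.+ y ≢ 0ℚ → ν x ℚ.⊓ ν y ℚ.≤ ν (x ℚ.+ y)
  ultrametric {x} {y} x≢0 y≢0 x+y≢0 with ℤ.≤-total (ordℚ p x) (ordℚ p y)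
  ... | inj₁ x≤y = ℚ.≤-trans (ℚ.p⊓q≤p (ν x) (ν y)) (ℤ⇒ℚ-mono (ordℚ-+ p-prime x≢0 y≢0 x+y≢0 x≤y))
  ... | inj₂ y≤x = ℚ.≤-trans (ℚ.p⊓q≤q (ν x) (ν y))
      (subst (λ z → ν y ℚ.≤ ν z) (ℚ.+-comm y x)
        (ℤ⇒ℚ-mono (ordℚ-+ p-prime y≢0 x≢0 (λ eq → x+y≢0 (trans (ℚ.+-comm x y) eq)) y≤x)))

  located : ∀ x s → (∃[ x≢0 ] ν x ℚ.≤ s) ⊎ (x ≢ 0ℚ → s ℚ.< ν x)
  located x s with x ℚ.≟ 0ℚ | ν x ℚ.≤? s
  ... | yes x≡0 | _       = inj₂ (λ x≢0 → ⊥-elim (x≢0 x≡0))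
  ... | no  x≢0 | yes x≤s = inj₁ (x≢0 , x≤s)
  ... | no  x≢0 | no  x≰s = inj₂ (λ _ → ℚ.≰⇒> x≰s)

-- ℚₚ, an algebraic closure of it, and the completion ℂₚ of that.
record PAdicTower {p} (p-prime : Prime p) c ℓ₁ ℓ₂ : Set (lsuc (c ⊔ ℓ₁ ⊔ ℓ₂)) where
  field
    ℚₚ-completion : Completion (ℚ-valued p-prime) c ℓ₁ ℓ₂
  ℚₚ : ValuedField c ℓ₁ ℓ₂
  ℚₚ = Completion.valuedField ℚₚ-completion

  field
    ℚₚ-closure : AlgebraicClosure ℚₚ c ℓ₁ ℓ₂
  ℚ̄ₚ : ValuedField c ℓ₁ ℓ₂
  ℚ̄ₚ = AlgebraicClosure.valuedField ℚₚ-closure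

  field
    ℂₚ-completion : Completion ℚ̄ₚ c ℓ₁ ℓ₂
  ℂₚ : ValuedField c ℓ₁ ℓ₂
  ℂₚ = Completion.valuedField ℂₚ-completion

  ℚₚ↪ℂₚ : Embedding ℚₚ ℂₚ
  ℚₚ↪ℂₚ = Completion.embedding ℂₚ-completion ∘ᵉ AlgebraicClosure.embedding ℚₚ-closure

  ℚ↪ℂₚ : Embedding (ℚ-valued p-prime) ℂₚ
  ℚ↪ℂₚ = ℚₚ↪ℂₚ ∘ᵉ Completion.embedding ℚₚ-completion

  ℤₚ : Set (c ⊔ ℓ₂)
  ℤₚ = ∃[ y ] 0ℚ ≤v y
    where open ValuedField ℚₚ

-- Coefficient lists, constant coefficient first.
module Polynomials (R : RawSemiring c ℓ₁) where
  open RawSemiring R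

  Poly : Set c
  Poly = List Carrier

  coeff : Poly → ℕ → Carrier
  coeff []       _       = 0#
  coeff (a ∷ f) zero    = a
  coeff (a ∷ f) (suc n) = coeff f n

  const : Carrier → Poly
  const a = a ∷ []

  monomial : Carrier → ℕ → Poly
  monomial a n = replicate n 0# ++ const a

  _+ₚ_ : Poly → Poly → Poly
  []      +ₚ g       = g
  (a ∷ f) +ₚ []      = a ∷ f
  (a ∷ f) +ₚ (b ∷ g) = (a + b) ∷ (f +ₚ g)

  _*ₚ_ : Poly → Poly → Poly
  []      *ₚ g = []
  (a ∷ f) *ₚ g = map (a *_) g +ₚ (0# ∷ (f *ₚ g))

  eval : Poly → Carrier → Carrier
  eval []      x = 0#
  eval (a ∷ f) x = a + x * eval f x

  polySemiring : RawSemiring c ℓ₁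
  polySemiring = record
    { Carrier = Poly
    ; _≈_     = λ f g → ∀ n → coeff f n ≈ coeff g n
    ; _+_     = _+ₚ_
    ; _*_     = _*ₚ_
    ; 0#      = []
    ; 1#      = const 1#
    }

-- A formal power series is its sequence of coefficients.
module PowerSeries (R : RawSemiring c ℓ₁) where
  open RawSemiring R
  open RawSum +-rawMonoid using (sum)

  Series : Set c
  Series = ℕ → Carrier

  infixl 7 _⊛_
  _⊛_ : Series → Series → Series
  (f ⊛ g) n = sum {suc n} (λ i → f (toℕ i) * g (n ℕ.∸ toℕ i))

  one : Series
  one zero    = 1#
  one (suc _) = 0#

module Reciprocal (R : CommutativeRing c ℓ₁) where
  open CommutativeRing R renaming (refl to ≈-refl; sym to ≈-sym; trans to ≈-trans)
  open PowerSeries (Semiring.rawSemiring semiring)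
  open Sum +-monoid using (sum; sum-cong-≋)

  -- The coefficients g n, ..., g 0 of the reciprocal g of f, where u is the
  -- inverse of f 0: g (n + 1) = - u (f 1 g n + ... + f (n + 1) g 0).
  recips : Series → Carrier → ∀ n → Vector Carrier (suc n)
  recips f u zero    = Vector._∷_ u Vector.[]
  recips f u (suc n) = Vector._∷_ (- (u * sum {suc n} (λ i → f (suc (toℕ i)) * recips f u n i))) (recips f u n)

  recip : Series → Carrier → Series
  recip f u n = recips f u n Fin.zero

  recips-lookup : ∀ f u n i → recips f u n i ≡ recip f u (n ℕ.∸ toℕ i)
  recips-lookup f u n       Fin.zero     = refl
  recips-lookup f u (suc n) (Fin.suc i) = recips-lookup f u n i

  recip-inverse : ∀ f u → f 0 * u ≈ 1# → ∀ n → (f ⊛ recip f u) n ≈ one n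
  recip-inverse f u f0u≈1 zero    = ≈-trans (+-identityʳ _) f0u≈1
  recip-inverse f u f0u≈1 (suc n) = begin
    f 0 * - (u * S) + sum {suc n} (λ i → f (suc (toℕ i)) * recip f u (n ℕ.∸ toℕ i))
      ≈⟨ +-cong (≈-sym (-‿distribʳ-* (f 0) (u * S)))
           (sum-cong-≋ {suc n} (λ i → *-congˡ {f (suc (toℕ i))} (reflexive (sym (recips-lookup f u n i))))) ⟩
    - (f 0 * (u * S)) + S
      ≈⟨ +-congʳ (-‿cong (≈-trans (≈-sym (*-assoc (f 0) u S)) (≈-trans (*-congʳ f0u≈1) (*-identityˡ S)))) ⟩
    - S + S
      ≈⟨ -‿inverseˡ S ⟩
    0# ∎
    where
    open ≈-Reasoning setoid
    open RingProperties ring using (-‿distribʳ-*)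
    S = sum {suc n} (λ i → f (suc (toℕ i)) * recips f u n i)

module EulerPolynomials {p} {p-prime : Prime p} (p-odd : ¬ 2 ∣ p) (T : PAdicTower p-prime c ℓ₁ ℓ₂) where
  open PAdicTower T public using (ℤₚ)
  open PAdicTower T using (ℂₚ; ℚₚ↪ℂₚ; ℚ↪ℂₚ)
  open ValuedField ℂₚ public
    using (Carrier; _≈_; _+_; _*_; _-_; -_; 0#; 1#; _^_; sum-syntax)
  open ValuedField ℂₚ
    using (_#_; v; v-cong; _<v_; #⇒invertible; *-congˡ; *-identityʳ; +-cong; +-congʳ; rawSemiring; commutativeRing)
    renaming (sym to ≈-sym; trans to ≈-trans)
  open ValuedFieldProperties ℂₚ
  open Polynomials rawSemiring public using (Poly; eval)
  open Polynomials rawSemiring using (const; monomial; _*ₚ_; polySemiring)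
  open PowerSeries
  open Reciprocal commutativeRing using (recip)
  private module ι = Embedding ℚ↪ℂₚ

  ℤₚ⇒ℂₚ : ℤₚ → Carrier
  ℤₚ⇒ℂₚ (y , _) = Embedding.⟦_⟧ ℚₚ↪ℂₚ y

  infixl 7 _/ℕ_
  _/ℕ_ : ℕ → (d : ℕ) .{{_ : NonZero d}} → Carrier
  m /ℕ d = ι.⟦ + m ℚ./ d ⟧

  fromℕ : ℕ → Carrier
  fromℕ m = m /ℕ 1

  p-1-nonZero : NonZero (p ℕ.∸ 1)
  p-1-nonZero = helper p (prime⇒nonTrivial p-prime)
    where
    helper : ∀ n → NonTrivial n → NonZero (n ℕ.∸ 1)
    helper (suc (suc _)) _ = _

  1/[p-1] : ℚ
  1/[p-1] = ℚ._/_ (+ 1) (p ℕ.∸ 1) {{p-1-nonZero}}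

  -- |r - 1| < p^(-1/(p-1))
  Disc : Carrier → Set ℓ₂
  Disc r = 1/[p-1] <v (r - 1#)

  0<1/[p-1] : 0ℚ ℚ.< 1/[p-1]
  0<1/[p-1] = ℚ.positive⁻¹ 1/[p-1] {{ℚ.normalize-pos 1 (p ℕ.∸ 1) {{p-1-nonZero}}}}

  disc-^ : ∀ {r} → Disc r → ∀ w → Disc (r ^ w)
  disc-^ {r} r∈ w = <v-pow r w 0<1/[p-1] r∈

  disc⇒r+1#0 : ∀ {r} → Disc r → r + 1# # 0#
  disc⇒r+1#0 r∈ = 1+1-unit⇒1+x#0 1+1#0 v[1+1]≡0 (λ h → ℚ.<-trans 0<1/[p-1] (r∈ h))
    where
    2ℚ : ℚ
    2ℚ = + 2 ℚ./ 1
    ι2≈1+1 : ι.⟦ 2ℚ ⟧ ≈ 1# + 1#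
    ι2≈1+1 = ≈-trans (ι.+-homo ℚ.1ℚ ℚ.1ℚ) (+-cong ι.1#-homo ι.1#-homo)
    ι2#0 : ι.⟦ 2ℚ ⟧ # 0#
    ι2#0 = ι.#0-preserving {2ℚ} (λ ())
    1+1#0 : 1# + 1# # 0#
    1+1#0 = #-congʳ ι2≈1+1 ι2#0
    1<p : 1 ℕ.< p
    1<p = ℕ.nonTrivial⇒n>1 p {{prime⇒nonTrivial p-prime}}
    p∤1 : ¬ p ∣ 1
    p∤1 p∣1 = ℕ.<⇒≱ 1<p (∣⇒≤ p∣1)
    p∤2 : ¬ p ∣ 2
    p∤2 p∣2 = p-odd (subst (_∣ p) (ℕ.≤-antisym (∣⇒≤ p∣2) 1<p) ∣-refl)
    v[1+1]≡0 : v (1# + 1#) 1+1#0 ≡ 0ℚ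
    v[1+1]≡0 = trans (v-cong (≈-sym ι2≈1+1) 1+1#0 ι2#0)
      (trans (ι.v-preserving 2ℚ (λ ()) ι2#0)
        (cong₂ (λ a b → ℤ⇒ℚ (+ a ℤ.- + b))
          (ord-unique p-prime {0} {2} (2 , refl , p∤2)) (ord-unique p-prime {0} {1} (1 , refl , p∤1))))

  1/_! : ℕ → Carrier
  1/ n ! = _/ℕ_ 1 (n ℕ.!) {{n ℕ.!≢0}}

  re^t+1 : Carrier → Series rawSemiring
  re^t+1 r n = r * 1/ n ! + one rawSemiring n

  re^t+1-unit : ∀ {r} → Disc r → re^t+1 r 0 # 0#
  re^t+1-unit {r} r∈ = #-congʳ
    (+-congʳ (≈-sym (≈-trans (*-congˡ ι.1#-homo) (*-identityʳ r)))) (disc⇒r+1#0 r∈)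

  2/[re^t+1] : ∀ r → Disc r → Series rawSemiring
  2/[re^t+1] r r∈ n = fromℕ 2 * recip (re^t+1 r) (proj₁ (#⇒invertible (re^t+1-unit r∈))) n

  e^xt : Series polySemiring
  e^xt n = monomial (1/ n !) n

  -- E n r is n! times the coefficient of t^n in 2/(re^t+1) · e^(xt) ∈ ℂₚ[x][[t]].
  E : ℕ → ∀ r → Disc r → Poly
  E n r r∈ = const (fromℕ (n ℕ.!)) *ₚ
             (_⊛_ polySemiring (λ k → const (2/[re^t+1] r r∈ k)) e^xt) n

{-# OPTIONS --safe #-}
module Submission where

-- Put X(a,b) = - q^(ab) e^(abt) and V(a,b) = 1/(1 - X(a,b)) in ℂₚ[[t]].  Up to the factor n!, the first
-- expression is the coefficient of t^n in
--   2 e^(w₁w₂w₃yt) V(w₁,w₂) (∑_{i<w₁} X(w₂,w₃)^i) (∑_{j<w₂} X(w₁,w₃)^j),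
-- and the other two arise from it by cyclic permutation.  Since w₁ and w₃ are odd,
-- X(w₂,w₃)^w₁ = - q^(w₁w₂w₃) e^(w₁w₂w₃t) = X(w₁,w₂)^w₃, so summing the geometric series gives
-- V(w₁,w₂) ∑_{i<w₁} X(w₂,w₃)^i = V(w₂,w₃) ∑_{i<w₃} X(w₁,w₂)^i.

open import Defs
open import Algebra using (CommutativeRing; Semiring; RawSemiring)
import Algebra.Definitions.RawMonoid as RawSum
import Algebra.Properties.CommutativeSemiring.Binomial as Binomial
import Algebra.Properties.CommutativeSemiring.Exp as Exp
import Algebra.Properties.Ring as RingProperties
import Algebra.Properties.Semiring.Mult as Mult
import Algebra.Properties.Semiring.Sum as Sum
import Algebra.Solver.Ring.NaturalCoefficients.Default as SemiringSolver
open import Data.Empty using (⊥-elim)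
open import Data.Fin using (Fin; toℕ)
open import Data.Fin.Properties using (toℕ≤pred[n])
import Data.Integer as ℤ
import Data.Integer.Properties as ℤ
open import Data.List using ([]; _∷_; map)
open import Data.Nat as ℕ using (ℕ; zero; suc; NonZero)
open import Data.Nat.Combinatorics using (_C_; nCk≡n!/k![n-k]!)
open import Data.Nat.Combinatorics.Specification using ([n∸k]!k!∣n!)
open import Data.Nat.DivMod using (m/n*n≡m)
open import Data.Nat.Divisibility using (_∣_; _∣0; ∣m∣n⇒∣m+n; ∣-refl)
import Data.Nat.Properties as ℕ
import Data.Nat.Tactic.RingSolver as ℕR
open import Data.Nat.Primality using (Prime)
open import Data.Product using (_×_; _,_; proj₁; proj₂)
import Data.Rational as ℚ
import Data.Rational.Properties as ℚ
import Data.Rational.Unnormalised as ℚᵘ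
import Data.Rational.Unnormalised.Properties as ℚᵘ
import Relation.Binary.Reasoning.Setoid as ≈-Reasoning
open import Relation.Binary.PropositionalEquality as ≡ using (_≡_)
open import Relation.Nullary using (¬_)

-- Geometric sums and signs of odd powers in a commutative ring.

module Geometric {c ℓ} (R : CommutativeRing c ℓ) where
  open CommutativeRing R
  open Exp commutativeSemiring using (_^_)
  open Sum semiring using (sum-syntax; sum-cong-≋; *-distribˡ-sum; *-distribʳ-sum)
  open RingProperties ring using (-‿distribˡ-*; -‿distribʳ-*; -‿involutive)
  open SemiringSolver commutativeSemiring using (solve; _:=_; _:+_; _:*_; con)
  open ≈-Reasoning setoid

  geometric : Carrier → ℕ → Carrier
  geometric x m = ∑[ i < m ] (x ^ toℕ i)

  geometric-sum : ∀ x m → (1# - x) * geometric x m ≈ 1# - x ^ m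
  geometric-sum x zero    = trans (zeroʳ _) (sym (-‿inverseʳ 1#))
  geometric-sum x (suc m) = begin
    (1# - x) * (1# + ∑[ i < m ] (x * x ^ toℕ i))  ≈⟨ *-congˡ (+-congˡ (*-distribˡ-sum {m} x (λ i → x ^ toℕ i))) ⟨
    (1# - x) * (1# + x * geometric x m)           ≈⟨ solve 3 (λ d x g → d :* (con 1 :+ x :* g) := d :+ x :* (d :* g)) refl (1# - x) x _ ⟩
    1# - x + x * ((1# - x) * geometric x m)       ≈⟨ +-congˡ (*-congˡ (geometric-sum x m)) ⟩
    1# - x + x * (1# - x ^ m)                     ≈⟨ +-congˡ (distribˡ x 1# _) ⟩
    1# - x + (x * 1# + x * - x ^ m)               ≈⟨ +-congˡ (+-cong (*-identityʳ x) (sym (-‿distribʳ-* x _))) ⟩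
    1# - x + (x - x * x ^ m)                      ≈⟨ solve 3 (λ n x y → con 1 :+ n :+ (x :+ y) := con 1 :+ y :+ (n :+ x)) refl (- x) x (- (x * x ^ m)) ⟩
    1# - x * x ^ m + (- x + x)                    ≈⟨ +-congˡ (-‿inverseˡ x) ⟩
    1# - x * x ^ m + 0#                           ≈⟨ +-identityʳ _ ⟩
    1# - x * x ^ m                                ∎

  -- Induction in steps of two, which preserve parity; the case m = 0 contradicts oddness because 2
  -- divides 0.
  -‿^-odd : ∀ x m → ¬ 2 ∣ m → (- x) ^ m ≈ - (x ^ m)
  -‿^-odd x zero          odd = ⊥-elim (odd (2 ∣0))
  -‿^-odd x (suc zero)    odd = sym (-‿distribˡ-* x 1#)
  -‿^-odd x (suc (suc m)) odd = begin
    - x * (- x * (- x) ^ m)   ≈⟨ *-congˡ (*-congˡ (-‿^-odd x m (λ 2∣m → odd (∣m∣n⇒∣m+n ∣-refl 2∣m)))) ⟩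
    - x * (- x * - (x ^ m))   ≈⟨ *-congˡ (-‿distribˡ-* x _) ⟨
    - x * - (x * - (x ^ m))   ≈⟨ *-congˡ (-‿cong (-‿distribʳ-* x _)) ⟨
    - x * - - (x * x ^ m)     ≈⟨ *-congˡ (-‿involutive _) ⟩
    - x * (x * x ^ m)         ≈⟨ -‿distribˡ-* x _ ⟨
    - (x * (x * x ^ m))       ∎

  -- This rearrangement and the two after it are proved in an abstract ring and later applied to
  -- products of power series.
  *-reverse : ∀ a b c → a * (b * c) ≈ c * (b * a)
  *-reverse = solve 3 (λ a b c → a :* (b :* c) := c :* (b :* a)) refl

  *-regroup : ∀ a b c d → a * b * (c * d) ≈ a * d * (b * c)
  *-regroup = solve 4 (λ a b c d → a :* b :* (c :* d) := a :* d :* (b :* c)) refl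

  *-interchange : ∀ a b c d → a * b * (c * d) ≈ a * c * (b * d)
  *-interchange = solve 4 (λ a b c d → a :* b :* (c :* d) := a :* c :* (b :* d)) refl

  -- Both sides are (1 - y^k) / ((1 - x)(1 - y)), since 1 - y^k and 1 - x^l coincide.
  geometric-quotient : ∀ {x y x⁻ y⁻} k l → (1# - x) * x⁻ ≈ 1# → (1# - y) * y⁻ ≈ 1# →
                       y ^ k ≈ x ^ l → x⁻ * geometric y k ≈ y⁻ * geometric x l
  geometric-quotient {x} {y} {x⁻} {y⁻} k l xx⁻ yy⁻ yᵏ≈xˡ = begin
    x⁻ * geometric y k                      ≈⟨ *-identityˡ _ ⟨
    -- The inserted (1 - y) y⁻ supplies the factor 1 - y that collapses the sum of powers of y to 1
    -- - y^k.
    1# * (x⁻ * geometric y k)               ≈⟨ *-congʳ yy⁻ ⟨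
    (1# - y) * y⁻ * (x⁻ * geometric y k)    ≈⟨ swap (1# - y) y⁻ x⁻ _ ⟩
    y⁻ * x⁻ * ((1# - y) * geometric y k)    ≈⟨ *-congˡ (geometric-sum y k) ⟩
    y⁻ * x⁻ * (1# - y ^ k)                  ≈⟨ *-cong (*-comm _ _) (+-congˡ (-‿cong yᵏ≈xˡ)) ⟩
    x⁻ * y⁻ * (1# - x ^ l)                  ≈⟨ *-congˡ (geometric-sum x l) ⟨
    x⁻ * y⁻ * ((1# - x) * geometric x l)    ≈⟨ swap (1# - x) x⁻ y⁻ _ ⟨
    (1# - x) * x⁻ * (y⁻ * geometric x l)    ≈⟨ *-congʳ xx⁻ ⟩
    1# * (y⁻ * geometric x l)               ≈⟨ *-identityˡ _ ⟩
    y⁻ * geometric x l                      ∎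
    where
    swap : ∀ a b c d → a * b * (c * d) ≈ b * c * (a * d)
    swap = solve 4 (λ a b c d → a :* b :* (c :* d) := b :* c :* (a :* d)) refl

  -- Read in the ring of power series, this expands the product of the overview into one series for
  -- each index pair (i, j).
  *-geometric-geometric : ∀ z x y k l → z * (geometric x k * geometric y l) ≈
                          ∑[ i < k ] (∑[ j < l ] (z * (x ^ toℕ i * y ^ toℕ j)))
  *-geometric-geometric z x y k l = begin
    z * (geometric x k * geometric y l)
      ≈⟨ *-congˡ (*-distribʳ-sum {k} (geometric y l) (λ i → x ^ toℕ i)) ⟩
    z * (∑[ i < k ] (x ^ toℕ i * geometric y l))
      ≈⟨ *-distribˡ-sum {k} z (λ i → x ^ toℕ i * geometric y l) ⟩
    ∑[ i < k ] (z * (x ^ toℕ i * geometric y l))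
      ≈⟨ sum-cong-≋ {k} (λ i → trans (*-congˡ (*-distribˡ-sum {l} (x ^ toℕ i) (λ j → y ^ toℕ j)))
                              (*-distribˡ-sum {l} z (λ j → x ^ toℕ i * y ^ toℕ j))) ⟩
    ∑[ i < k ] (∑[ j < l ] (z * (x ^ toℕ i * y ^ toℕ j)))
      ∎

-- The commutative ring of formal power series and the substitution of a t for t.

module SeriesRing {c ℓ} (R : CommutativeRing c ℓ) where
  open CommutativeRing R
  open PowerSeries (Semiring.rawSemiring semiring) public
  open Exp commutativeSemiring using (_^_)
  open Sum semiring using (sum; sum-cong-≋)
  open SemiringSolver commutativeSemiring using (solve; _:=_; _:+_; _:*_; con)
  open ≈-Reasoning setoid

  infix 4 _≈ₛ_
  infixl 6 _⊕_
  infixr 8 _•_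

  _≈ₛ_ : Series → Series → Set ℓ
  f ≈ₛ g = ∀ n → f n ≈ g n

  _⊕_ : Series → Series → Series
  (f ⊕ g) n = f n + g n

  _•_ : Carrier → Series → Series
  (a • f) n = a * f n

  -- By computation `(f ⊛ g) (suc n)` is `f 0 * g (suc n) + (tail f ⊛ g) n`; the inductions on the
  -- coefficient index below rest on this.
  tail : Series → Series
  tail f n = f (suc n)

  ⊛-cong : ∀ {f f′ g g′} → f ≈ₛ f′ → g ≈ₛ g′ → f ⊛ g ≈ₛ f′ ⊛ g′
  ⊛-cong f≈ g≈ n = sum-cong-≋ {suc n} (λ i → *-cong (f≈ (toℕ i)) (g≈ (n ℕ.∸ toℕ i)))

  ⊛-distribʳ : ∀ h f g → (f ⊕ g) ⊛ h ≈ₛ f ⊛ h ⊕ g ⊛ h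
  ⊛-distribʳ h f g zero    =
    solve 3 (λ a b c → (a :+ b) :* c :+ con 0 := a :* c :+ con 0 :+ (b :* c :+ con 0)) refl (f 0) (g 0) (h 0)
  ⊛-distribʳ h f g (suc n) = trans (+-congˡ (⊛-distribʳ h (tail f) (tail g) n))
    (solve 5 (λ a b c d e → (a :+ b) :* c :+ (d :+ e) := a :* c :+ d :+ (b :* c :+ e)) refl (f 0) (g 0) (h (suc n)) _ _)

  •-⊛ : ∀ a f g → (a • f) ⊛ g ≈ₛ a • (f ⊛ g)
  •-⊛ a f g zero    = solve 3 (λ a b c → a :* b :* c :+ con 0 := a :* (b :* c :+ con 0)) refl a (f 0) (g 0)
  •-⊛ a f g (suc n) = trans (+-congˡ (•-⊛ a (tail f) g n))
    (solve 4 (λ a b c d → a :* b :* c :+ a :* d := a :* (b :* c :+ d)) refl a (f 0) (g (suc n)) _)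

  ⊛-assoc : ∀ f g h → (f ⊛ g) ⊛ h ≈ₛ f ⊛ (g ⊛ h)
  ⊛-assoc f g h zero    =
    solve 3 (λ a b c → (a :* b :+ con 0) :* c :+ con 0 := a :* (b :* c :+ con 0) :+ con 0) refl (f 0) (g 0) (h 0)
  ⊛-assoc f g h (suc n) = begin
    -- Here `tail (f ⊛ g)` has unfolded to `f 0 • tail g ⊕ tail f ⊛ g`.
    (f 0 * g 0 + 0#) * h (suc n) + ((f 0 • tail g ⊕ tail f ⊛ g) ⊛ h) n
      ≈⟨ +-congˡ (trans (⊛-distribʳ h (f 0 • tail g) (tail f ⊛ g) n)
           (+-cong (•-⊛ (f 0) (tail g) h n) (⊛-assoc (tail f) g h n))) ⟩
    (f 0 * g 0 + 0#) * h (suc n) + (f 0 * (tail g ⊛ h) n + (tail f ⊛ (g ⊛ h)) n)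
      ≈⟨ solve 5 (λ a b c d e → (a :* b :+ con 0) :* c :+ (a :* d :+ e) := a :* (b :* c :+ d) :+ e)
           refl (f 0) (g 0) (h (suc n)) _ _ ⟩
    f 0 * (g 0 * h (suc n) + (tail g ⊛ h) n) + (tail f ⊛ (g ⊛ h)) n
      ∎

  -- Splits off the last summand of the convolution, whereas unfolding splits off the first;
  -- `⊛-comm` compares the two splittings.
  ⊛-sucʳ : ∀ f g n → (f ⊛ g) (suc n) ≈ f (suc n) * g 0 + (f ⊛ tail g) n
  ⊛-sucʳ f g zero    =
    solve 4 (λ a b c d → a :* b :+ (c :* d :+ con 0) := c :* d :+ (a :* b :+ con 0)) refl (f 0) (g 1) (f 1) (g 0)
  ⊛-sucʳ f g (suc n) = trans (+-congˡ (⊛-sucʳ (tail f) g n))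
    (solve 3 (λ a b c → a :+ (b :+ c) := b :+ (a :+ c)) refl _ _ _)

  ⊛-comm : ∀ f g → f ⊛ g ≈ₛ g ⊛ f
  ⊛-comm f g zero    = +-congʳ (*-comm _ _)
  ⊛-comm f g (suc n) = trans (+-cong (*-comm _ _) (⊛-comm (tail f) g n)) (sym (⊛-sucʳ g f n))

  ⊛-zeroˡ : ∀ f → (λ _ → 0#) ⊛ f ≈ₛ (λ _ → 0#)
  ⊛-zeroˡ f zero    = trans (+-identityʳ _) (zeroˡ _)
  ⊛-zeroˡ f (suc n) = trans (+-cong (zeroˡ _) (⊛-zeroˡ f n)) (+-identityʳ 0#)

  ⊛-identityˡ : ∀ f → one ⊛ f ≈ₛ f
  ⊛-identityˡ f zero    = trans (+-identityʳ _) (*-identityˡ _)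
  ⊛-identityˡ f (suc n) = trans (+-cong (*-identityˡ _) (⊛-zeroˡ f n)) (+-identityʳ _)

  -- Makes the results on geometric sums in an abstract ring available for power series.
  seriesRing : CommutativeRing c ℓ
  seriesRing = record
    { Carrier = Series
    ; _≈_     = _≈ₛ_
    ; _+_     = _⊕_
    ; _*_     = _⊛_
    ; -_      = λ f n → - f n
    ; 0#      = λ _ → 0#
    ; 1#      = one
    ; isCommutativeRing = record
      { isRing = record
        { +-isAbelianGroup = record
          { isGroup = record
            { isMonoid = record
              { isSemigroup = record
                { isMagma = record
                  { isEquivalence = record
                    { refl  = λ _ → refl
                    ; sym   = λ f≈g n → sym (f≈g n)
                    ; trans = λ f≈g g≈h n → trans (f≈g n) (g≈h n)
                    }
                  ; ∙-cong = λ f≈ g≈ n → +-cong (f≈ n) (g≈ n)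
                  }
                ; assoc = λ f g h n → +-assoc (f n) (g n) (h n)
                }
              ; identity = (λ f n → +-identityˡ (f n)) , (λ f n → +-identityʳ (f n))
              }
            ; inverse = (λ f n → -‿inverseˡ (f n)) , (λ f n → -‿inverseʳ (f n))
            ; ⁻¹-cong = λ f≈ n → -‿cong (f≈ n)
            }
          ; comm = λ f g n → +-comm (f n) (g n)
          }
        ; *-cong     = ⊛-cong
        ; *-assoc    = ⊛-assoc
        ; *-identity = ⊛-identityˡ , λ f n → trans (⊛-comm f one n) (⊛-identityˡ f n)
        ; distrib    = (λ h f g n → trans (⊛-comm h (f ⊕ g) n)
                         (trans (⊛-distribʳ h f g n) (+-cong (⊛-comm f h n) (⊛-comm g h n))))
                     , ⊛-distribʳ
        }
      ; *-comm = ⊛-comm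
      }
    }

  private module S = CommutativeRing seriesRing

  sum-at : ∀ {m} (f : Fin m → Series) n → Sum.sum S.semiring f n ≡ sum (λ i → f i n)
  sum-at {zero}  f n = ≡.refl
  sum-at {suc m} f n = ≡.cong (f Fin.zero n +_) (sum-at (λ i → f (Fin.suc i)) n)

  •-⊛-• : ∀ a b f g → (a • f) ⊛ (b • g) ≈ₛ (a * b) • (f ⊛ g)
  •-⊛-• a b f g n = begin
    ((a • f) ⊛ (b • g)) n   ≈⟨ •-⊛ a f (b • g) n ⟩
    a * (f ⊛ (b • g)) n     ≈⟨ *-congˡ (trans (⊛-comm f (b • g) n) (•-⊛ b g f n)) ⟩
    a * (b * (g ⊛ f) n)     ≈⟨ *-congˡ (*-congˡ (⊛-comm g f n)) ⟩
    a * (b * (f ⊛ g) n)     ≈⟨ *-assoc a b _ ⟨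
    a * b * (f ⊛ g) n       ∎

  -- The substitution f(t) ↦ f(a t).
  dilate : Carrier → Series → Series
  dilate a f n = a ^ n * f n

  dilate-⊛ : ∀ a f g → dilate a (f ⊛ g) ≈ₛ dilate a f ⊛ dilate a g
  dilate-⊛ a f g zero    =
    solve 2 (λ b c → con 1 :* (b :* c :+ con 0) := con 1 :* b :* (con 1 :* c) :+ con 0) refl (f 0) (g 0)
  dilate-⊛ a f g (suc n) = begin
    a * a ^ n * (f 0 * g (suc n) + (tail f ⊛ g) n)
      ≈⟨ solve 5 (λ a b c d e → a :* b :* (c :* d :+ e) := con 1 :* c :* (a :* b :* d) :+ a :* (b :* e))
           refl a (a ^ n) (f 0) (g (suc n)) _ ⟩
    1# * f 0 * (a * a ^ n * g (suc n)) + a * dilate a (tail f ⊛ g) n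
      ≈⟨ +-congˡ (trans (*-congˡ (dilate-⊛ a (tail f) g n)) (sym (•-⊛ a (dilate a (tail f)) (dilate a g) n))) ⟩
    1# * f 0 * (a * a ^ n * g (suc n)) + ((a • dilate a (tail f)) ⊛ dilate a g) n
      -- `a • dilate a (tail f)` and `tail (dilate a f)` differ only in the bracketing of a a^k f (k
      -- + 1).
      ≈⟨ +-congˡ (⊛-cong {g = dilate a g} (λ k → sym (*-assoc a (a ^ k) (f (suc k)))) (λ _ → refl) n) ⟩
    1# * f 0 * (a * a ^ n * g (suc n)) + (tail (dilate a f) ⊛ dilate a g) n
      ∎

  dilate-one : ∀ a → dilate a one ≈ₛ one
  dilate-one a zero    = *-identityˡ 1#
  dilate-one a (suc n) = zeroʳ _

-- The exponential series and its addition law.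

record IsInverseFactorial {c ℓ} (R : CommutativeRing c ℓ) (1/_! : ℕ → CommutativeRing.Carrier R) : Set ℓ where
  open CommutativeRing R
  open Mult semiring using () renaming (_×_ to _×ᵣ_)
  field
    1/0!≈1        : 1/ 0 ! ≈ 1#
    1/k!*1/[n-k]! : ∀ {n k} → k ℕ.≤ n → 1/ k ! * 1/ n ℕ.∸ k ! ≈ (n C k) ×ᵣ 1/ n !

module Exponential {c ℓ} (R : CommutativeRing c ℓ) (1/_! : ℕ → CommutativeRing.Carrier R)
                   (isInverseFactorial : IsInverseFactorial R 1/_!) where
  open CommutativeRing R
  open IsInverseFactorial isInverseFactorial
  open SeriesRing R
  open Exp commutativeSemiring using (_^_; ^-congˡ; ^-distrib-*)
  open Sum semiring using (sum-syntax; sum-cong-≋; *-distribʳ-sum)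
  open Mult semiring using (×-comm-*; ×-assoc-*) renaming (_×_ to _×ᵣ_)
  open SemiringSolver commutativeSemiring using (solve; _:=_; _:*_)
  open ≈-Reasoning setoid
  private module S = CommutativeRing seriesRing
  open Exp S.commutativeSemiring using () renaming (_^_ to _^ₛ_)

  -- The series e^(xt) in the variable t, so the argument x is the rate.
  exp : Carrier → Series
  exp x n = x ^ n * 1/ n !

  exp-cong : ∀ {x y} → x ≈ y → exp x ≈ₛ exp y
  exp-cong x≈y n = *-congʳ (^-congˡ n x≈y)

  exp-0 : exp 0# ≈ₛ one
  exp-0 zero    = trans (*-identityˡ _) 1/0!≈1
  exp-0 (suc n) = trans (*-congʳ (zeroˡ _)) (zeroˡ _)

  -- This is the binomial theorem divided by n!, where C(n,k)/n! splits as 1/k! times 1/(n-k)!.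
  exp-+ : ∀ x y → exp x ⊛ exp y ≈ₛ exp (x + y)
  exp-+ x y n = sym (begin
    (x + y) ^ n * 1/ n !
      ≈⟨ *-congʳ (Binomial.theorem commutativeSemiring n x y) ⟩
    Binomial.binomialExpansion commutativeSemiring x y n * 1/ n !
      ≈⟨ *-distribʳ-sum {suc n} (1/ n !) (Binomial.binomialTerm commutativeSemiring x y n) ⟩
    ∑[ k < suc n ] (((n C toℕ k) ×ᵣ (x ^ toℕ k * y ^ (n ℕ.∸ toℕ k))) * 1/ n !)
      ≈⟨ sum-cong-≋ {suc n} (λ k → term (toℕ k) (toℕ≤pred[n] k)) ⟩
    (exp x ⊛ exp y) n
      ∎)
    where
    term : ∀ k → k ℕ.≤ n → ((n C k) ×ᵣ (x ^ k * y ^ (n ℕ.∸ k))) * 1/ n ! ≈ exp x k * exp y (n ℕ.∸ k)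
    term k k≤n = begin
      ((n C k) ×ᵣ (x ^ k * y ^ (n ℕ.∸ k))) * 1/ n !       ≈⟨ ×-assoc-* (n C k) _ _ ⟩
      (n C k) ×ᵣ (x ^ k * y ^ (n ℕ.∸ k) * 1/ n !)         ≈⟨ ×-comm-* (n C k) _ _ ⟨
      x ^ k * y ^ (n ℕ.∸ k) * ((n C k) ×ᵣ 1/ n !)         ≈⟨ *-congˡ (1/k!*1/[n-k]! k≤n) ⟨
      x ^ k * y ^ (n ℕ.∸ k) * (1/ k ! * 1/ n ℕ.∸ k !)     ≈⟨ solve 4 (λ a b c d → a :* b :* (c :* d) := a :* c :* (b :* d)) refl (x ^ k) _ _ _ ⟩
      x ^ k * 1/ k ! * (y ^ (n ℕ.∸ k) * 1/ n ℕ.∸ k !)     ∎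

  dilate-exp : ∀ a x → dilate a (exp x) ≈ₛ exp (a * x)
  dilate-exp a x n = trans (sym (*-assoc _ _ _)) (*-congʳ (sym (^-distrib-* a x n)))

  •exp-^ : ∀ a x m → (a • exp x) ^ₛ m ≈ₛ (a ^ m) • exp (m ×ᵣ x)
  •exp-^ a x zero    n = sym (trans (*-identityˡ _) (exp-0 n))
  •exp-^ a x (suc m) n = begin
    ((a • exp x) ⊛ (a • exp x) ^ₛ m) n           ≈⟨ ⊛-cong {f = a • exp x} (λ _ → refl) (•exp-^ a x m) n ⟩
    ((a • exp x) ⊛ ((a ^ m) • exp (m ×ᵣ x))) n     ≈⟨ •-⊛-• a (a ^ m) (exp x) (exp (m ×ᵣ x)) n ⟩
    a * a ^ m * (exp x ⊛ exp (m ×ᵣ x)) n         ≈⟨ *-congˡ (exp-+ x (m ×ᵣ x) n) ⟩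
    a * a ^ m * exp (x + m ×ᵣ x) n               ∎

-- Evaluation of polynomials respects sums and products.

module Evaluation {c ℓ} (R : CommutativeRing c ℓ) where
  open CommutativeRing R
  open Polynomials (Semiring.rawSemiring semiring)
  open Exp commutativeSemiring using (_^_)
  open Sum semiring using (sum; sum-cong-≋)
  open SemiringSolver commutativeSemiring using (solve; _:=_; _:+_; _:*_; con)
  open PowerSeries using (_⊛_)

  eval-const : ∀ a x → eval (const a) x ≈ a
  eval-const a x = trans (+-congˡ (zeroʳ x)) (+-identityʳ a)

  eval-monomial : ∀ a n x → eval (monomial a n) x ≈ x ^ n * a
  eval-monomial a zero    x = trans (eval-const a x) (sym (*-identityˡ a))
  eval-monomial a (suc n) x =
    trans (+-identityˡ _) (trans (*-congˡ (eval-monomial a n x)) (sym (*-assoc x _ a)))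

  eval-+ₚ : ∀ f g x → eval (f +ₚ g) x ≈ eval f x + eval g x
  eval-+ₚ []      g       x = sym (+-identityˡ _)
  eval-+ₚ (a ∷ f) []      x = sym (+-identityʳ _)
  eval-+ₚ (a ∷ f) (b ∷ g) x = trans (+-congˡ (*-congˡ (eval-+ₚ f g x)))
    (solve 5 (λ a b x f g → a :+ b :+ x :* (f :+ g) := a :+ x :* f :+ (b :+ x :* g)) refl a b x _ _)

  eval-map-* : ∀ a f x → eval (map (a *_) f) x ≈ a * eval f x
  eval-map-* a []      x = sym (zeroʳ a)
  eval-map-* a (b ∷ f) x = trans (+-congˡ (*-congˡ (eval-map-* a f x)))
    (solve 4 (λ a b x f → a :* b :+ x :* (a :* f) := a :* (b :+ x :* f)) refl a b x _)

  eval-*ₚ : ∀ f g x → eval (f *ₚ g) x ≈ eval f x * eval g x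
  eval-*ₚ []      g x = sym (zeroˡ _)
  eval-*ₚ (a ∷ f) g x =
    trans (eval-+ₚ (map (a *_) g) (0# ∷ (f *ₚ g)) x)
      (trans (+-cong (eval-map-* a g x) (+-congˡ (*-congˡ (eval-*ₚ f g x))))
        (solve 4 (λ a x f g → a :* g :+ (con 0 :+ x :* (f :* g)) := (a :+ x :* f) :* g) refl a x _ _))

  eval-sum : ∀ {m} (f : Fin m → Poly) x →
             eval (RawSum.sum (RawSemiring.+-rawMonoid polySemiring) f) x ≈ sum (λ i → eval (f i) x)
  eval-sum {zero}  f x = refl
  eval-sum {suc m} f x = trans (eval-+ₚ (f Fin.zero) _ x) (+-congˡ (eval-sum (λ i → f (Fin.suc i)) x))

  -- Lets x be specialised in a power series with polynomial coefficients, so that the generating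
  -- function becomes a product of series over the ring itself.
  eval-⊛ : ∀ f g n x → eval (_⊛_ polySemiring f g n) x ≈
           _⊛_ (Semiring.rawSemiring semiring) (λ k → eval (f k) x) (λ k → eval (g k) x) n
  eval-⊛ f g n x = trans (eval-sum {suc n} (λ i → f (toℕ i) *ₚ g (n ℕ.∸ toℕ i)) x)
    (sum-cong-≋ {suc n} (λ i → eval-*ₚ (f (toℕ i)) (g (n ℕ.∸ toℕ i)) x))

-- Products of fractions and the factorial formula for binomial coefficients.

/-*-/ : ∀ m n k d e f .{{_ : NonZero d}} .{{_ : NonZero e}} .{{_ : NonZero f}} →
        m ℕ.* n ℕ.* f ≡ k ℕ.* (d ℕ.* e) →
        ((ℤ.+ m) ℚ./ d) ℚ.* ((ℤ.+ n) ℚ./ e) ≡ (ℤ.+ k) ℚ./ f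
/-*-/ m n k d@(suc _) e@(suc _) f@(suc _) mnf≡kde = ℚ.toℚᵘ-injective (begin
  ℚ.toℚᵘ ((ℤ.+ m) ℚ./ d ℚ.* ((ℤ.+ n) ℚ./ e))
    ≈⟨ ℚ.toℚᵘ-homo-* ((ℤ.+ m) ℚ./ d) ((ℤ.+ n) ℚ./ e) ⟩
  ℚ.toℚᵘ ((ℤ.+ m) ℚ./ d) ℚᵘ.* ℚ.toℚᵘ ((ℤ.+ n) ℚ./ e)
    ≈⟨ ℚᵘ.*-cong (ℚ.toℚᵘ-fromℚᵘ ((ℤ.+ m) ℚᵘ./ d)) (ℚ.toℚᵘ-fromℚᵘ ((ℤ.+ n) ℚᵘ./ e)) ⟩
  ((ℤ.+ m) ℚᵘ./ d) ℚᵘ.* ((ℤ.+ n) ℚᵘ./ e)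
    -- Equality of unnormalised fractions is cross multiplication, so the hypothesis on natural
    -- numbers only has to be moved to the integers.
    ≈⟨ ℚᵘ.*≡* cross ⟩
  (ℤ.+ k) ℚᵘ./ f
    ≈⟨ ℚ.toℚᵘ-fromℚᵘ ((ℤ.+ k) ℚᵘ./ f) ⟨
  ℚ.toℚᵘ ((ℤ.+ k) ℚ./ f) ∎)
  where
  open ≈-Reasoning ℚᵘ.≃-setoid
  cross : (ℤ.+ m) ℤ.* (ℤ.+ n) ℤ.* (ℤ.+ f) ≡ (ℤ.+ k) ℤ.* (ℤ.+ (d ℕ.* e))
  cross = ≡.trans (≡.cong (ℤ._* (ℤ.+ f)) (≡.sym (ℤ.pos-* m n)))
    (≡.trans (≡.sym (ℤ.pos-* (m ℕ.* n) f)) (≡.trans (≡.cong ℤ.+_ mnf≡kde) (ℤ.pos-* k (d ℕ.* e))))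

-- The quotient formula for C(n,k) uses division of natural numbers, which is exact because k!(n-k)!
-- divides n!.
nCk*k![n-k]!≡n! : ∀ {n k} → k ℕ.≤ n → (n C k) ℕ.* (k ℕ.! ℕ.* (n ℕ.∸ k) ℕ.!) ≡ n ℕ.!
nCk*k![n-k]!≡n! {n} {k} k≤n = ≡.trans (≡.cong (ℕ._* d) (nCk≡n!/k![n-k]! k≤n))
  (m/n*n≡m {{_}} (≡.subst (_∣ n ℕ.!) (ℕ.*-comm ((n ℕ.∸ k) ℕ.!) (k ℕ.!)) ([n∸k]!k!∣n! k≤n)))
  where d = k ℕ.! ℕ.* (n ℕ.∸ k) ℕ.!

-- The generating function of the Euler polynomials over ℂₚ.

module PAdic {c ℓ₁ ℓ₂ p} {p-prime : Prime p} (p-odd : ¬ 2 ∣ p) (T : PAdicTower p-prime c ℓ₁ ℓ₂) where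
  open EulerPolynomials p-odd T
  open PAdicTower T using (ℂₚ; ℚ↪ℂₚ)
  open ValuedField ℂₚ using (commutativeRing; _#_; #⇒invertible)
  open CommutativeRing commutativeRing using (commutativeSemiring; semiring; ring; setoid; refl; sym; trans; reflexive;
    +-cong; +-congˡ; +-congʳ; *-cong; *-congˡ; *-congʳ; *-assoc; *-comm; *-identityˡ; zeroˡ; distribʳ; -‿cong)
  open Mult semiring using () renaming (_×_ to _×ᵣ_)
  open ≈-Reasoning setoid
  private module ι = Embedding ℚ↪ℂₚ

  /ℕ-*-/ℕ : ∀ m n k d e f .{{_ : NonZero d}} .{{_ : NonZero e}} .{{_ : NonZero f}} →
            m ℕ.* n ℕ.* f ≡ k ℕ.* (d ℕ.* e) → (m /ℕ d) * (n /ℕ e) ≈ k /ℕ f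
  /ℕ-*-/ℕ m n k d e f eq = trans (sym (ι.*-homo _ _)) (ι.⟦⟧-cong (/-*-/ m n k d e f eq))

  fromℕ-* : ∀ m n → fromℕ (m ℕ.* n) ≈ fromℕ m * fromℕ n
  fromℕ-* m n = sym (/ℕ-*-/ℕ m n (m ℕ.* n) 1 1 1 ≡.refl)

  -- Reconciles repeated addition, in which the binomial theorem and the powers of exponentials are
  -- phrased, with the image of m under the embedding of ℚ.
  ×≈fromℕ* : ∀ m x → m ×ᵣ x ≈ fromℕ m * x
  ×≈fromℕ* zero    x = sym (trans (*-congʳ ι.0#-homo) (zeroˡ x))
  ×≈fromℕ* (suc m) x = begin
    x + m ×ᵣ x               ≈⟨ +-cong (sym (*-identityˡ x)) (×≈fromℕ* m x) ⟩
    1# * x + fromℕ m * x     ≈⟨ distribʳ x 1# (fromℕ m) ⟨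
    (1# + fromℕ m) * x       ≈⟨ *-congʳ (+-congʳ ι.1#-homo) ⟨
    (fromℕ 1 + fromℕ m) * x  ≈⟨ *-congʳ (ι.+-homo _ _) ⟨
    ι.⟦ ℤ⇒ℚ (ℤ.+ 1) ℚ.+ ℤ⇒ℚ (ℤ.+ m) ⟧ * x  ≈⟨ *-congʳ (ι.⟦⟧-cong (ℤ⇒ℚ-+ (ℤ.+ 1) (ℤ.+ m))) ⟨
    fromℕ (suc m) * x        ∎

  1/k!*1/[n-k]! : ∀ {n k} → k ℕ.≤ n → 1/ k ! * 1/ n ℕ.∸ k ! ≈ (n C k) ×ᵣ 1/ n !
  1/k!*1/[n-k]! {n} {k} k≤n = begin
    1/ k ! * 1/ n ℕ.∸ k !      ≈⟨ /ℕ-*-/ℕ 1 1 (n C k) (k ℕ.!) ((n ℕ.∸ k) ℕ.!) (n ℕ.!) {{k ℕ.!≢0}} {{(n ℕ.∸ k) ℕ.!≢0}} {{n ℕ.!≢0}}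
                                    (≡.trans (ℕ.*-identityˡ _) (≡.sym (nCk*k![n-k]!≡n! k≤n))) ⟩
    (_/ℕ_ (n C k) (n ℕ.!) {{n ℕ.!≢0}})  ≈⟨ /ℕ-*-/ℕ (n C k) 1 (n C k) 1 (n ℕ.!) (n ℕ.!) {{_}} {{n ℕ.!≢0}} {{n ℕ.!≢0}}
                                    (≡.cong₂ ℕ._*_ (ℕ.*-identityʳ (n C k)) (≡.sym (ℕ.*-identityˡ (n ℕ.!)))) ⟨
    fromℕ (n C k) * 1/ n !     ≈⟨ ×≈fromℕ* (n C k) _ ⟨
    (n C k) ×ᵣ 1/ n !          ∎

  isInverseFactorial : IsInverseFactorial commutativeRing 1/_!
  isInverseFactorial = record { 1/0!≈1 = ι.1#-homo ; 1/k!*1/[n-k]! = 1/k!*1/[n-k]! }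

  open Exponential commutativeRing 1/_! isInverseFactorial

  open SeriesRing commutativeRing
  open Evaluation commutativeRing
  open Reciprocal commutativeRing using (recip; recip-inverse)
  open Exp commutativeSemiring using (^-congʳ; ^-congˡ; ^-distrib-*; ^-homo-*; ^-assocʳ)
  open RingProperties ring using (-‿distribˡ-*; -‿involutive; -1*x≈-x)
  open Polynomials (Semiring.rawSemiring semiring) using (const; _*ₚ_; polySemiring)
  open Sum semiring using (sum-cong-≋; *-distribˡ-sum)
  open SemiringSolver commutativeSemiring using (solve; _:=_; _:+_; _:*_)
  private
    module S = CommutativeRing seriesRing
    module Sₑ = Exp S.commutativeSemiring
  open Geometric seriesRing using
    (geometric; geometric-quotient; *-geometric-geometric; *-reverse; *-regroup; *-interchange)
  open Geometric commutativeRing using (-‿^-odd)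

  -- E n r r∈ is by definition eulerPoly n r (re^t+1-unit r∈).  The proof is a parameter because
  -- comparing two instances of re^t+1-unit unfolds the p-adic estimates and does not finish.
  eulerPoly : ℕ → ∀ r → re^t+1 r 0 # 0# → Poly
  eulerPoly n r r+1#0 = const (fromℕ (n ℕ.!)) *ₚ
    PowerSeries._⊛_ polySemiring (λ k → const (fromℕ 2 * recip (re^t+1 r) (proj₁ (#⇒invertible r+1#0)) k)) e^xt n

  abstract
    -- The generating function at x = 0 without its numerator 2. It is sealed, so that later
    -- arguments see only its inverse law and its link to `eulerPoly`, not the recursion for the
    -- reciprocal.
    1/[re^t+1] : ∀ r → re^t+1 r 0 # 0# → Series
    1/[re^t+1] r r+1#0 = recip (re^t+1 r) (proj₁ (#⇒invertible r+1#0))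

    re^t+1-inverse : ∀ r r+1#0 → re^t+1 r ⊛ 1/[re^t+1] r r+1#0 ≈ₛ one
    -- `#⇒invertible` provides a left inverse of the difference `re^t+1 r 0 - 0#`; commuting and
    -- dropping the zero gives the form needed.
    re^t+1-inverse r r+1#0 = recip-inverse (re^t+1 r) _
      (trans (*-comm _ _) (trans (*-congˡ (sym (x-0≈x _))) (proj₁ (proj₂ (#⇒invertible r+1#0)))))
      where open ValuedFieldProperties ℂₚ using (x-0≈x)

    -- Evaluating the generating function coefficient by coefficient turns `e^xt` into `exp x`; the
    -- numerator 2 then comes out as a scalar.
    eval-eulerPoly : ∀ n r r+1#0 x → eval (eulerPoly n r r+1#0) x ≈
                     fromℕ (n ℕ.!) * (fromℕ 2 * (1/[re^t+1] r r+1#0 ⊛ exp x) n)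
    eval-eulerPoly n r r+1#0 x = begin
      eval (eulerPoly n r r+1#0) x
        ≈⟨ eval-*ₚ (const (fromℕ (n ℕ.!))) (PowerSeries._⊛_ polySemiring P e^xt n) x ⟩
      eval (const (fromℕ (n ℕ.!))) x * eval (PowerSeries._⊛_ polySemiring P e^xt n) x
        ≈⟨ *-cong (eval-const (fromℕ (n ℕ.!)) x) (eval-⊛ P e^xt n x) ⟩
      fromℕ (n ℕ.!) * ((λ k → eval (P k) x) ⊛ (λ k → eval (e^xt k) x)) n
        ≈⟨ *-congˡ (⊛-cong (λ k → eval-const (fromℕ 2 * 1/[re^t+1] r r+1#0 k) x) (λ k → eval-monomial (1/ k !) k x) n) ⟩
      fromℕ (n ℕ.!) * ((fromℕ 2 • 1/[re^t+1] r r+1#0) ⊛ exp x) n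
        ≈⟨ *-congˡ (•-⊛ (fromℕ 2) (1/[re^t+1] r r+1#0) (exp x) n) ⟩
      fromℕ (n ℕ.!) * (fromℕ 2 * (1/[re^t+1] r r+1#0 ⊛ exp x) n)
        ∎
      where
      P : ℕ → Poly
      P k = const (fromℕ 2 * 1/[re^t+1] r r+1#0 k)

  -- A factor a^n on the coefficient of t^n amounts to replacing t by a t, which absorbs the
  -- prefactors (w₁w₂)^n of the theorem into the series.
  ^*eval-eulerPoly : ∀ n r r+1#0 a x → a ^ n * eval (eulerPoly n r r+1#0) x ≈
                     fromℕ (n ℕ.!) * (fromℕ 2 * (dilate a (1/[re^t+1] r r+1#0) ⊛ exp (a * x)) n)
  ^*eval-eulerPoly n r r+1#0 a x = begin
    a ^ n * eval (eulerPoly n r r+1#0) x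
      ≈⟨ *-congˡ (eval-eulerPoly n r r+1#0 x) ⟩
    a ^ n * (fromℕ (n ℕ.!) * (fromℕ 2 * (V ⊛ exp x) n))
      ≈⟨ solve 4 (λ a b c d → a :* (b :* (c :* d)) := b :* (c :* (a :* d))) refl (a ^ n) _ _ _ ⟩
    fromℕ (n ℕ.!) * (fromℕ 2 * dilate a (V ⊛ exp x) n)
      ≈⟨ *-congˡ (*-congˡ (dilate-⊛ a V (exp x) n)) ⟩
    fromℕ (n ℕ.!) * (fromℕ 2 * (dilate a V ⊛ dilate a (exp x)) n)
      ≈⟨ *-congˡ (*-congˡ (⊛-cong {f = dilate a V} (λ _ → refl) (dilate-exp a x) n)) ⟩
    fromℕ (n ℕ.!) * (fromℕ 2 * (dilate a V ⊛ exp (a * x)) n)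
      ∎
    where V = 1/[re^t+1] r r+1#0

  -- Replace t by a t in the inverse law. The series r e^(at) + 1 is written 1 - (- r) e^(at) to
  -- match the denominator of a geometric sum.
  dilate-inverse : ∀ r r+1#0 a → (one S.- (- r) • exp a) ⊛ dilate a (1/[re^t+1] r r+1#0) ≈ₛ one
  dilate-inverse r r+1#0 a n = begin
    ((one S.- (- r) • exp a) ⊛ V) n                          ≈⟨ ⊛-cong {g = V} dilated (λ _ → refl) n ⟨
    (dilate a (re^t+1 r) ⊛ V) n                              ≈⟨ dilate-⊛ a (re^t+1 r) (1/[re^t+1] r r+1#0) n ⟨
    dilate a (re^t+1 r ⊛ 1/[re^t+1] r r+1#0) n               ≈⟨ *-congˡ (re^t+1-inverse r r+1#0 n) ⟩
    dilate a one n                                           ≈⟨ dilate-one a n ⟩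
    one n                                                    ∎
    where
    V = dilate a (1/[re^t+1] r r+1#0)
    dilated : dilate a (re^t+1 r) ≈ₛ one S.- (- r) • exp a
    dilated k = begin
      a ^ k * (r * 1/ k ! + one k)            ≈⟨ solve 4 (λ a r f o → a :* (r :* f :+ o) := a :* o :+ r :* (a :* f)) refl (a ^ k) r _ _ ⟩
      a ^ k * one k + r * exp a k             ≈⟨ +-cong (dilate-one a k) (sym (-‿involutive _)) ⟩
      one k - - (r * exp a k)                 ≈⟨ +-congˡ (-‿cong (-‿distribˡ-* r _)) ⟩
      one k - - r * exp a k                   ∎

  -- The double sums as coefficients of power series, and their cyclic symmetry.

  module _ (q : Carrier) where

    -- This is X(a,b) of the overview with m = ab, on which alone it depends.
    -q^e : ℕ → Series
    -q^e m = (- (q ^ m)) • exp (fromℕ m)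

    -- An odd power keeps the minus sign, so the power stays in the same family; this is where
    -- oddness of the weights enters.
    -q^e-^-odd : ∀ m w → ¬ 2 ∣ w → -q^e m Sₑ.^ w ≈ₛ -q^e (m ℕ.* w)
    -q^e-^-odd m w w-odd n = trans (•exp-^ (- (q ^ m)) (fromℕ m) w n) (*-cong
      (trans (-‿^-odd (q ^ m) w w-odd) (-‿cong (^-assocʳ q m w)))
      (exp-cong (trans (×≈fromℕ* w (fromℕ m)) (trans (*-comm _ _) (sym (fromℕ-* m w)))) n))

    -- Yields the sign, the power of q and the shift of the argument in the (i, j) term of a double
    -- sum.
    -q^e-^-*-^ : ∀ a b i j → -q^e a Sₑ.^ i ⊛ -q^e b Sₑ.^ j ≈ₛ
                 ((- 1#) ^ (i ℕ.+ j) * q ^ (a ℕ.* i ℕ.+ b ℕ.* j)) • exp (fromℕ a * fromℕ i + fromℕ b * fromℕ j)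
    -q^e-^-*-^ a b i j n = begin
      (-q^e a Sₑ.^ i ⊛ -q^e b Sₑ.^ j) n
        ≈⟨ ⊛-cong (power a i) (power b j) n ⟩
      ((((- 1#) ^ i * q ^ (a ℕ.* i)) • exp (fromℕ a * fromℕ i)) ⊛ (((- 1#) ^ j * q ^ (b ℕ.* j)) • exp (fromℕ b * fromℕ j))) n
        ≈⟨ •-⊛-• _ _ (exp (fromℕ a * fromℕ i)) (exp (fromℕ b * fromℕ j)) n ⟩
      ((- 1#) ^ i * q ^ (a ℕ.* i)) * ((- 1#) ^ j * q ^ (b ℕ.* j)) * (exp (fromℕ a * fromℕ i) ⊛ exp (fromℕ b * fromℕ j)) n
        ≈⟨ *-cong (solve 4 (λ a b c d → a :* b :* (c :* d) := a :* c :* (b :* d)) refl ((- 1#) ^ i) _ _ _)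
             (exp-+ (fromℕ a * fromℕ i) (fromℕ b * fromℕ j) n) ⟩
      ((- 1#) ^ i * (- 1#) ^ j) * (q ^ (a ℕ.* i) * q ^ (b ℕ.* j)) * exp (fromℕ a * fromℕ i + fromℕ b * fromℕ j) n
        ≈⟨ *-congʳ (*-cong (^-homo-* (- 1#) i j) (^-homo-* q (a ℕ.* i) (b ℕ.* j))) ⟨
      (- 1#) ^ (i ℕ.+ j) * q ^ (a ℕ.* i ℕ.+ b ℕ.* j) * exp (fromℕ a * fromℕ i + fromℕ b * fromℕ j) n
        ∎
      where
      power : ∀ a i → -q^e a Sₑ.^ i ≈ₛ ((- 1#) ^ i * q ^ (a ℕ.* i)) • exp (fromℕ a * fromℕ i)
      power a i k = trans (•exp-^ (- (q ^ a)) (fromℕ a) i k) (*-cong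
        -- Writing - q^a as (- 1) q^a separates the sign for i of either parity.
        (trans (^-congˡ i (sym (-1*x≈-x (q ^ a)))) (trans (^-distrib-* (- 1#) (q ^ a) i) (*-congˡ (^-assocʳ q a i))))
        (exp-cong (trans (×≈fromℕ* i (fromℕ a)) (*-comm _ _)) k))

    -- The polynomial is a parameter, which keeps the proof about r out of the sum and allows the
    -- index q^(w₁w₃) beside the prefactor (w₃w₁)^n.
    eulerSum : ∀ (w₁ w₂ w₃ : ℕ) .{{_ : NonZero w₁}} .{{_ : NonZero w₂}} → Poly → ℕ → Carrier → Carrier
    eulerSum w₁ w₂ w₃ P n y = fromℕ (w₁ ℕ.* w₂) ^ n * ∑[ i < w₁ ] (∑[ j < w₂ ]
      ((- 1#) ^ (toℕ i ℕ.+ toℕ j) * q ^ (w₃ ℕ.* (w₂ ℕ.* toℕ i ℕ.+ w₁ ℕ.* toℕ j))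
        * eval P (fromℕ w₃ * y + (w₃ /ℕ w₁) * fromℕ (toℕ i) + (w₃ /ℕ w₂) * fromℕ (toℕ j))))

    -- The product of the overview without its factor 2; for r = q^(w₁w₂) the dilated reciprocal is
    -- V(w₁,w₂).
    eulerSeries : ∀ (w₁ w₂ w₃ : ℕ) r → re^t+1 r 0 # 0# → Carrier → Series
    eulerSeries w₁ w₂ w₃ r r+1#0 y =
      exp (fromℕ (w₁ ℕ.* w₂) * (fromℕ w₃ * y)) ⊛ dilate (fromℕ (w₁ ℕ.* w₂)) (1/[re^t+1] r r+1#0)
        ⊛ (geometric (-q^e (w₃ ℕ.* w₂)) w₁ ⊛ geometric (-q^e (w₃ ℕ.* w₁)) w₂)

    -- Each term is a coefficient of t^n once the prefactor is absorbed; by linearity the sum is the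
    -- coefficient of a double sum of series, which factors into two geometric sums.
    eulerSum≈ : ∀ w₁ w₂ w₃ .{{_ : NonZero w₁}} .{{_ : NonZero w₂}} n r r+1#0 y →
      eulerSum w₁ w₂ w₃ (eulerPoly n r r+1#0) n y ≈ fromℕ (n ℕ.!) * (fromℕ 2 * eulerSeries w₁ w₂ w₃ r r+1#0 y n)
    eulerSum≈ w₁ w₂ w₃ n r r+1#0 y = begin
      a ^ n * ∑[ i < w₁ ] (∑[ j < w₂ ] (sign i j * value i j))
        ≈⟨ *-distribˡ-∑∑ (a ^ n) (λ i j → sign i j * value i j) ⟩
      ∑[ i < w₁ ] (∑[ j < w₂ ] (a ^ n * (sign i j * value i j)))
        ≈⟨ ∑∑-cong term ⟩
      ∑[ i < w₁ ] (∑[ j < w₂ ] (N * (F ⊛ (X Sₑ.^ toℕ i ⊛ Y Sₑ.^ toℕ j)) n))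
        ≈⟨ *-distribˡ-∑∑ N (λ i j → (F ⊛ (X Sₑ.^ toℕ i ⊛ Y Sₑ.^ toℕ j)) n) ⟨
      N * ∑[ i < w₁ ] (∑[ j < w₂ ] ((F ⊛ (X Sₑ.^ toℕ i ⊛ Y Sₑ.^ toℕ j)) n))
        -- Sums of n-th coefficients become the n-th coefficient of a sum, first for the inner index
        -- and then for the outer one.
        ≈⟨ *-congˡ (sum-cong-≋ {w₁} (λ i → reflexive (sum-at {w₂} (λ j → F ⊛ (X Sₑ.^ toℕ i ⊛ Y Sₑ.^ toℕ j)) n))) ⟨
      N * ∑[ i < w₁ ] (Sum.sum S.semiring {w₂} (λ j → F ⊛ (X Sₑ.^ toℕ i ⊛ Y Sₑ.^ toℕ j)) n)
        ≈⟨ *-congˡ (reflexive (sum-at {w₁} (λ i → Sum.sum S.semiring {w₂} (λ j → F ⊛ (X Sₑ.^ toℕ i ⊛ Y Sₑ.^ toℕ j))) n)) ⟨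
      N * Sum.sum S.semiring {w₁} (λ i → Sum.sum S.semiring {w₂} (λ j → F ⊛ (X Sₑ.^ toℕ i ⊛ Y Sₑ.^ toℕ j))) n
        ≈⟨ *-congˡ (*-geometric-geometric F X Y w₁ w₂ n) ⟨
      N * (F ⊛ (geometric X w₁ ⊛ geometric Y w₂)) n
        ≈⟨ *-assoc _ _ _ ⟩
      fromℕ (n ℕ.!) * (fromℕ 2 * eulerSeries w₁ w₂ w₃ r r+1#0 y n)
        ∎
      where
      a N : Carrier
      a = fromℕ (w₁ ℕ.* w₂)
      N = fromℕ (n ℕ.!) * fromℕ 2
      V F X Y : Series
      V = dilate a (1/[re^t+1] r r+1#0)
      F = exp (a * (fromℕ w₃ * y)) ⊛ V
      X = -q^e (w₃ ℕ.* w₂)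
      Y = -q^e (w₃ ℕ.* w₁)
      sign value arg : Fin w₁ → Fin w₂ → Carrier
      sign i j = (- 1#) ^ (toℕ i ℕ.+ toℕ j) * q ^ (w₃ ℕ.* (w₂ ℕ.* toℕ i ℕ.+ w₁ ℕ.* toℕ j))
      arg i j = fromℕ w₃ * y + (w₃ /ℕ w₁) * fromℕ (toℕ i) + (w₃ /ℕ w₂) * fromℕ (toℕ j)
      value i j = eval (eulerPoly n r r+1#0) (arg i j)

      ∑∑-cong : {f g : Fin w₁ → Fin w₂ → Carrier} → (∀ i j → f i j ≈ g i j) →
                ∑[ i < w₁ ] (∑[ j < w₂ ] f i j) ≈ ∑[ i < w₁ ] (∑[ j < w₂ ] g i j)
      ∑∑-cong f≈g = sum-cong-≋ {w₁} (λ i → sum-cong-≋ {w₂} (f≈g i))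

      *-distribˡ-∑∑ : ∀ z (f : Fin w₁ → Fin w₂ → Carrier) →
                      z * ∑[ i < w₁ ] (∑[ j < w₂ ] f i j) ≈ ∑[ i < w₁ ] (∑[ j < w₂ ] (z * f i j))
      *-distribˡ-∑∑ z f = trans (*-distribˡ-sum {w₁} z (λ i → ∑[ j < w₂ ] f i j))
        (sum-cong-≋ {w₁} (λ i → *-distribˡ-sum {w₂} z (f i)))

      -- Multiplying by w₁w₂ clears the denominators w₁ and w₂ and leaves the exponents that X^i and
      -- Y^j contribute.
      a*arg : ∀ i j → a * arg i j ≈ a * (fromℕ w₃ * y)
                + (fromℕ (w₃ ℕ.* w₂) * fromℕ (toℕ i) + fromℕ (w₃ ℕ.* w₁) * fromℕ (toℕ j))
      a*arg i j = begin
        a * arg i j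
          ≈⟨ solve 6 (λ a x u k v l → a :* (x :+ u :* k :+ v :* l) := a :* x :+ (a :* u :* k :+ a :* v :* l))
               refl a (fromℕ w₃ * y) (w₃ /ℕ w₁) (fromℕ (toℕ i)) (w₃ /ℕ w₂) (fromℕ (toℕ j)) ⟩
        a * (fromℕ w₃ * y) + (a * (w₃ /ℕ w₁) * fromℕ (toℕ i) + a * (w₃ /ℕ w₂) * fromℕ (toℕ j))
          ≈⟨ +-congˡ (+-cong
               (*-congʳ (/ℕ-*-/ℕ (w₁ ℕ.* w₂) w₃ (w₃ ℕ.* w₂) 1 w₁ 1 (cancel₁ w₁ w₂ w₃)))
               (*-congʳ (/ℕ-*-/ℕ (w₁ ℕ.* w₂) w₃ (w₃ ℕ.* w₁) 1 w₂ 1 (cancel₂ w₁ w₂ w₃)))) ⟩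
        a * (fromℕ w₃ * y) + (fromℕ (w₃ ℕ.* w₂) * fromℕ (toℕ i) + fromℕ (w₃ ℕ.* w₁) * fromℕ (toℕ j))
          ∎
        where
        cancel₁ : ∀ u v w → u ℕ.* v ℕ.* w ℕ.* 1 ≡ w ℕ.* v ℕ.* (1 ℕ.* u)
        cancel₁ = ℕR.solve-∀
        cancel₂ : ∀ u v w → u ℕ.* v ℕ.* w ℕ.* 1 ≡ w ℕ.* u ℕ.* (1 ℕ.* v)
        cancel₂ = ℕR.solve-∀

      sign≈ : ∀ i j → (- 1#) ^ (toℕ i ℕ.+ toℕ j) * q ^ (w₃ ℕ.* w₂ ℕ.* toℕ i ℕ.+ w₃ ℕ.* w₁ ℕ.* toℕ j) ≈ sign i j
      sign≈ i j = *-congˡ (^-congʳ q (expand w₁ w₂ w₃ (toℕ i) (toℕ j)))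
        where
        expand : ∀ u v w k l → w ℕ.* v ℕ.* k ℕ.+ w ℕ.* u ℕ.* l ≡ w ℕ.* (v ℕ.* k ℕ.+ u ℕ.* l)
        expand = ℕR.solve-∀

      -- The exponential in F and the one from X^i Y^j merge by the addition law into e^(a arg t).
      coefficient : ∀ i j → (F ⊛ (X Sₑ.^ toℕ i ⊛ Y Sₑ.^ toℕ j)) n ≈ sign i j * (V ⊛ exp (a * arg i j)) n
      coefficient i j = begin
        (F ⊛ (X Sₑ.^ toℕ i ⊛ Y Sₑ.^ toℕ j)) n
          ≈⟨ ⊛-cong {f = F} (λ _ → refl) (λ k → trans (-q^e-^-*-^ (w₃ ℕ.* w₂) (w₃ ℕ.* w₁) (toℕ i) (toℕ j) k) (*-congʳ (sign≈ i j))) n ⟩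
        (F ⊛ (sign i j • exp z)) n
          ≈⟨ trans (⊛-comm F (sign i j • exp z) n) (•-⊛ (sign i j) (exp z) F n) ⟩
        sign i j * (exp z ⊛ F) n
          ≈⟨ *-congˡ (*-reverse (exp z) (exp (a * (fromℕ w₃ * y))) V n) ⟩
        sign i j * (V ⊛ (exp (a * (fromℕ w₃ * y)) ⊛ exp z)) n
          ≈⟨ *-congˡ (⊛-cong {f = V} (λ _ → refl) (λ k → trans (exp-+ _ z k) (exp-cong (sym (a*arg i j)) k)) n) ⟩
        sign i j * (V ⊛ exp (a * arg i j)) n
          ∎
        where
        z = fromℕ (w₃ ℕ.* w₂) * fromℕ (toℕ i) + fromℕ (w₃ ℕ.* w₁) * fromℕ (toℕ j)

      term : ∀ i j → a ^ n * (sign i j * value i j) ≈ N * (F ⊛ (X Sₑ.^ toℕ i ⊛ Y Sₑ.^ toℕ j)) n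
      term i j = begin
        a ^ n * (sign i j * value i j)
          ≈⟨ solve 3 (λ a s e → a :* (s :* e) := s :* (a :* e)) refl (a ^ n) (sign i j) (value i j) ⟩
        sign i j * (a ^ n * value i j)
          ≈⟨ *-congˡ (^*eval-eulerPoly n r r+1#0 a (arg i j)) ⟩
        sign i j * (fromℕ (n ℕ.!) * (fromℕ 2 * (V ⊛ exp (a * arg i j)) n))
          ≈⟨ solve 4 (λ s f t e → s :* (f :* (t :* e)) := f :* t :* (s :* e)) refl (sign i j) (fromℕ (n ℕ.!)) (fromℕ 2) _ ⟩
        N * (sign i j * (V ⊛ exp (a * arg i j)) n)
          ≈⟨ *-congˡ (coefficient i j) ⟨
        N * (F ⊛ (X Sₑ.^ toℕ i ⊛ Y Sₑ.^ toℕ j)) n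
          ∎

    -- Tying r to q^m only by an equation lets the index q^(w₁w₃) serve for m = w₃w₁.
    -q^e-inverse : ∀ m r r+1#0 → r ≡ q ^ m → (one S.- -q^e m) ⊛ dilate (fromℕ m) (1/[re^t+1] r r+1#0) ≈ₛ one
    -q^e-inverse m r r+1#0 ≡.refl = dilate-inverse r r+1#0 (fromℕ m)

    eulerSeries-cyclic : ∀ w₁ w₂ w₃ → ¬ 2 ∣ w₁ → ¬ 2 ∣ w₃ → ∀ r r+1#0 s s+1#0 →
      r ≡ q ^ (w₁ ℕ.* w₂) → s ≡ q ^ (w₂ ℕ.* w₃) → ∀ y →
      eulerSeries w₁ w₂ w₃ r r+1#0 y ≈ₛ eulerSeries w₂ w₃ w₁ s s+1#0 y
    eulerSeries-cyclic w₁ w₂ w₃ w₁-odd w₃-odd r r+1#0 s s+1#0 r≡ s≡ y = Sr.begin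
      e ⊛ V ⊛ (geometric (-q^e (w₃ ℕ.* w₂)) w₁ ⊛ geometric (-q^e (w₃ ℕ.* w₁)) w₂)
        Sr.≈⟨ S.*-congˡ {e ⊛ V} (S.*-cong (flip-exponent w₃ w₂ w₁) (flip-exponent w₃ w₁ w₂)) ⟩
      e ⊛ V ⊛ (geometric Y w₁ ⊛ G)
        Sr.≈⟨ *-regroup e V (geometric Y w₁) G ⟩
      e ⊛ G ⊛ (V ⊛ geometric Y w₁)
        Sr.≈⟨ S.*-cong {e ⊛ G} {e′ ⊛ G} (S.*-congʳ {G} {e} {e′} (exp-cong e≈))
               (geometric-quotient {X} {Y} {V} {V′} w₁ w₃
                 (-q^e-inverse (w₁ ℕ.* w₂) r r+1#0 r≡) (-q^e-inverse (w₂ ℕ.* w₃) s s+1#0 s≡) powers) ⟩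
      e′ ⊛ G ⊛ (V′ ⊛ geometric X w₃)
        Sr.≈⟨ *-interchange e′ G V′ (geometric X w₃) ⟩
      e′ ⊛ V′ ⊛ (G ⊛ geometric X w₃)
        Sr.∎
      where
      module Sr = ≈-Reasoning S.setoid
      e e′ V V′ X Y G : Series
      e  = exp (fromℕ (w₁ ℕ.* w₂) * (fromℕ w₃ * y))
      e′ = exp (fromℕ (w₂ ℕ.* w₃) * (fromℕ w₁ * y))
      V  = dilate (fromℕ (w₁ ℕ.* w₂)) (1/[re^t+1] r r+1#0)
      V′ = dilate (fromℕ (w₂ ℕ.* w₃)) (1/[re^t+1] s s+1#0)
      X  = -q^e (w₁ ℕ.* w₂)
      Y  = -q^e (w₂ ℕ.* w₃)
      G  = geometric (-q^e (w₁ ℕ.* w₃)) w₂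

      flip-exponent : ∀ a b k → geometric (-q^e (a ℕ.* b)) k ≈ₛ geometric (-q^e (b ℕ.* a)) k
      flip-exponent a b k n = reflexive (≡.cong (λ m → geometric (-q^e m) k n) (ℕ.*-comm a b))

      -- Both powers are `-q^e` at the product of all three weights.
      powers : Y Sₑ.^ w₁ ≈ₛ X Sₑ.^ w₃
      powers n = trans (-q^e-^-odd (w₂ ℕ.* w₃) w₁ w₁-odd n)
        (trans (reflexive (≡.cong (λ m → -q^e m n) (rotate w₁ w₂ w₃))) (sym (-q^e-^-odd (w₁ ℕ.* w₂) w₃ w₃-odd n)))
        where
        rotate : ∀ u v w → v ℕ.* w ℕ.* u ≡ u ℕ.* v ℕ.* w
        rotate = ℕR.solve-∀

      e≈ : fromℕ (w₁ ℕ.* w₂) * (fromℕ w₃ * y) ≈ fromℕ (w₂ ℕ.* w₃) * (fromℕ w₁ * y)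
      e≈ = begin
        fromℕ (w₁ ℕ.* w₂) * (fromℕ w₃ * y)        ≈⟨ *-congʳ (fromℕ-* w₁ w₂) ⟩
        fromℕ w₁ * fromℕ w₂ * (fromℕ w₃ * y)      ≈⟨ solve 4 (λ u v w y → u :* v :* (w :* y) := v :* w :* (u :* y)) refl (fromℕ w₁) (fromℕ w₂) (fromℕ w₃) y ⟩
        fromℕ w₂ * fromℕ w₃ * (fromℕ w₁ * y)      ≈⟨ *-congʳ (fromℕ-* w₂ w₃) ⟨
        fromℕ (w₂ ℕ.* w₃) * (fromℕ w₁ * y)        ∎

    eulerSum-cyclic : ∀ w₁ w₂ w₃ .{{_ : NonZero w₁}} .{{_ : NonZero w₂}} .{{_ : NonZero w₃}} →
      ¬ 2 ∣ w₁ → ¬ 2 ∣ w₃ → ∀ n r r+1#0 s s+1#0 → r ≡ q ^ (w₁ ℕ.* w₂) → s ≡ q ^ (w₂ ℕ.* w₃) → ∀ y →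
      eulerSum w₁ w₂ w₃ (eulerPoly n r r+1#0) n y ≈ eulerSum w₂ w₃ w₁ (eulerPoly n s s+1#0) n y
    eulerSum-cyclic w₁ w₂ w₃ w₁-odd w₃-odd n r r+1#0 s s+1#0 r≡ s≡ y =
      trans (eulerSum≈ w₁ w₂ w₃ n r r+1#0 y)
        (trans (*-congˡ (*-congˡ (eulerSeries-cyclic w₁ w₂ w₃ w₁-odd w₃-odd r r+1#0 s s+1#0 r≡ s≡ y n)))
          (sym (eulerSum≈ w₂ w₃ w₁ n s s+1#0 y)))

theorem4p14 : ∀ {c ℓ₁ ℓ₂} (p : ℕ) (p-prime : Prime p) (p-odd : ¬ 2 ∣ p)
  (T : PAdicTower p-prime c ℓ₁ ℓ₂) →
  let open EulerPolynomials p-odd T in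
  (q : Carrier) (q∈ : Disc q) →
  (w₁ w₂ w₃ : ℕ) .{{_ : NonZero w₁}} .{{_ : NonZero w₂}} .{{_ : NonZero w₃}} →
  ¬ 2 ∣ w₁ → ¬ 2 ∣ w₂ → ¬ 2 ∣ w₃ →
  (n : ℕ) (y₁ : ℤₚ) →
  let y : Carrier
      y = ℤₚ⇒ℂₚ y₁
      A : Carrier
      A = fromℕ (w₁ ℕ.* w₂) ^ n * ∑[ i < w₁ ] (∑[ j < w₂ ]
            ((- 1#) ^ (toℕ i ℕ.+ toℕ j) * q ^ (w₃ ℕ.* (w₂ ℕ.* toℕ i ℕ.+ w₁ ℕ.* toℕ j))
              * eval (E n (q ^ (w₁ ℕ.* w₂)) (disc-^ q∈ (w₁ ℕ.* w₂)))
                  (fromℕ w₃ * y + (w₃ /ℕ w₁) * fromℕ (toℕ i) + (w₃ /ℕ w₂) * fromℕ (toℕ j))))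
      B : Carrier
      B = fromℕ (w₂ ℕ.* w₃) ^ n * ∑[ i < w₂ ] (∑[ j < w₃ ]
            ((- 1#) ^ (toℕ i ℕ.+ toℕ j) * q ^ (w₁ ℕ.* (w₃ ℕ.* toℕ i ℕ.+ w₂ ℕ.* toℕ j))
              * eval (E n (q ^ (w₂ ℕ.* w₃)) (disc-^ q∈ (w₂ ℕ.* w₃)))
                  (fromℕ w₁ * y + (w₁ /ℕ w₂) * fromℕ (toℕ i) + (w₁ /ℕ w₃) * fromℕ (toℕ j))))
      C : Carrier
      C = fromℕ (w₃ ℕ.* w₁) ^ n * ∑[ i < w₃ ] (∑[ j < w₁ ]
            ((- 1#) ^ (toℕ i ℕ.+ toℕ j) * q ^ (w₂ ℕ.* (w₁ ℕ.* toℕ i ℕ.+ w₃ ℕ.* toℕ j))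
              * eval (E n (q ^ (w₁ ℕ.* w₃)) (disc-^ q∈ (w₁ ℕ.* w₃)))
                  (fromℕ w₂ * y + (w₂ /ℕ w₃) * fromℕ (toℕ i) + (w₂ /ℕ w₁) * fromℕ (toℕ j))))
  in A ≈ B × B ≈ C
theorem4p14 p p-prime p-odd T q q∈ w₁ w₂ w₃ odd₁ odd₂ odd₃ n y₁ =
    -- The underscores are the proofs that the constant terms are apart from 0, read off from the
    -- unfolded `E`.
    eulerSum-cyclic q w₁ w₂ w₃ odd₁ odd₃ n (q ^ (w₁ ℕ.* w₂)) _ (q ^ (w₂ ℕ.* w₃)) _ ≡.refl ≡.refl (ℤₚ⇒ℂₚ y₁)
  -- The same exchange with the weights rotated; the third index q^(w₁w₃) has to be matched with
  -- q^(w₃w₁).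
  , eulerSum-cyclic q w₂ w₃ w₁ odd₂ odd₁ n (q ^ (w₂ ℕ.* w₃)) _ (q ^ (w₁ ℕ.* w₃)) _
      ≡.refl (≡.cong (q ^_) (ℕ.*-comm w₁ w₃)) (ℤₚ⇒ℂₚ y₁)
  where
  open EulerPolynomials p-odd T using (_^_; ℤₚ⇒ℂₚ)
  open PAdic p-odd T using (eulerSum-cyclic)
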